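{- Let $r \in [0,1]$ be a real number. Then the following are equivalent: (1) $r$ is the upper density of a $\Sigma^0_2$ set; (2) $r$ is left-$\Pi^0_3$; (3) $r$ is the upper density of a $\Pi^0_1$ set.
   Context: For $X \subseteq \omega=\{0,1,2,\dots\}$ and an integer $m>0$, let $\rho_m(X) = |\{j \in X : j < m\}|/m$. The upper density of $X$ is $\overline{\rho}(X)=\limsup_m \rho_m(X)$. A real $r$ is left-$\Pi^0_3$ if its left Dedekind cut $\{q \in \mathbb{Q} : q < r\}$ is a $\Pi^0_3$ set. -}

module Defs where

open import Level using (0ℓ; Lift) renaming (suc to lsuc)
open import Axiom.ExcludedMiddle using (ExcludedMiddle)
open import Data.Fin using (Fin)
open import Data.Integer using (+_; _⊖_)
open import Data.List using (length; filter; upTo)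
open import Data.Nat using (ℕ; zero; suc; _+_; _<_; NonZero)
open import Data.Product using (∃; _×_; _,_)
open import Data.Rational using (ℚ; _/_; 1ℚ) renaming (_<_ to _<ℚ_; _-_ to _-ℚ_)
open import Data.Rational.Properties using (<-trans; <-irrefl; <-dense; positive⁻¹; neg-antimono-<; +-identityʳ; +-monoʳ-<)
open import Data.Sum using (_⊎_)
open import Data.Vec using (Vec; []; _∷_; lookup; head)
open import Data.Vec.Relation.Binary.Pointwise.Inductive using (Pointwise)
open import Function.Bundles using (_⇔_)
open import Relation.Binary.PropositionalEquality using (_≡_; refl; subst)
open import Relation.Nullary using (¬_)
open import Relation.Unary using (Pred; Decidable; _⊆_)

-- Codes for Kleene's partial recursive functions.
data Rec : ℕ → Set where
  zer  : Rec 0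
  succ : Rec 1
  proj : ∀ {n} → Fin n → Rec n
  comp : ∀ {m n} → Rec m → Vec (Rec n) m → Rec n
  prec : ∀ {n} → Rec n → Rec (suc (suc n)) → Rec (suc n)
  mu   : ∀ {n} → Rec (suc n) → Rec n

-- f [ xs ]⇓ y : the partial function with code f is defined at xs, with
-- value y.
data _[_]⇓_ : ∀ {n} → Rec n → Vec ℕ n → ℕ → Set where
  zer⇓   : zer [ [] ]⇓ 0
  succ⇓  : ∀ {x} → succ [ x ∷ [] ]⇓ suc x
  proj⇓  : ∀ {n} {xs : Vec ℕ n} (i : Fin n) → proj i [ xs ]⇓ lookup xs i
  comp⇓  : ∀ {m n} {f : Rec m} {gs : Vec (Rec n) m} {xs ys z} →
           Pointwise (λ g y → g [ xs ]⇓ y) gs ys → f [ ys ]⇓ z →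
           comp f gs [ xs ]⇓ z
  prec⇓₀ : ∀ {n} {f : Rec n} {g xs y} →
           f [ xs ]⇓ y → prec f g [ 0 ∷ xs ]⇓ y
  prec⇓₁ : ∀ {n} {f : Rec n} {g xs k y z} →
           prec f g [ k ∷ xs ]⇓ y → g [ k ∷ y ∷ xs ]⇓ z →
           prec f g [ suc k ∷ xs ]⇓ z
  -- Least zero, with f required to be defined at all smaller arguments.
  mu⇓    : ∀ {n} {f : Rec (suc n)} {xs y} →
           f [ y ∷ xs ]⇓ 0 →
           (∀ {i} → i < y → ∃ λ z → f [ i ∷ xs ]⇓ suc z) →
           mu f [ xs ]⇓ y

Relation : ℕ → Set₁
Relation n = Pred (Vec ℕ n) 0ℓ

-- The characteristic function of R is (total) recursive.
Computable : ∀ {n} → Relation n → Set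
Computable {n} R = ∃ λ (f : Rec n) →
  ∀ xs → (R xs × f [ xs ]⇓ 1) ⊎ (¬ R xs × f [ xs ]⇓ 0)

Σ⁰ Π⁰ : ∀ {n} → ℕ → Relation n → Set₁
Σ⁰     zero    R = Lift (lsuc 0ℓ) (Computable R)
Σ⁰ {n} (suc k) R = ∃ λ (S : Relation (suc n)) →
  Π⁰ k S × (∀ xs → R xs ⇔ (∃ λ y → S (y ∷ xs)))
Π⁰     zero    R = Lift (lsuc 0ℓ) (Computable R)
Π⁰ {n} (suc k) R = ∃ λ (S : Relation (suc n)) →
  Σ⁰ k S × (∀ xs → R xs ⇔ (∀ y → S (y ∷ xs)))

fromSet : Pred ℕ 0ℓ → Relation 1
fromSet X xs = X (head xs)

-- A set of rationals is classified through the presentation of ℚ in which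
-- (a , b , d) names (a - b) / (d + 1).
fromℚSet : Pred ℚ 0ℓ → Relation 3
fromℚSet A (a ∷ b ∷ d ∷ []) = A ((a ⊖ b) / suc d)

-- A real is given by its left Dedekind cut { q ∈ ℚ : q < r }.  No locatedness
-- is demanded: these are the classical reals, used together with excluded
-- middle.  Equality of reals is mutual _≤_.
record ℝ : Set₁ where
  field
    leftCut    : Pred ℚ 0ℓ
    inhabited  : ∃ λ q → leftCut q
    proper     : ∃ λ q → ¬ leftCut q
    downClosed : ∀ {p q} → p <ℚ q → leftCut q → leftCut p
    noMaximum  : ∀ {q} → leftCut q → ∃ λ p → q <ℚ p × leftCut p

open ℝ public using (leftCut)

infix 4 _≤_
_≤_ : ℝ → ℝ → Set
r ≤ s = leftCut r ⊆ leftCut s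

fromℚ : ℚ → ℝ
fromℚ q = record
  { leftCut    = _<ℚ q
  ; inhabited  = q -ℚ 1ℚ ,
      subst (q -ℚ 1ℚ <ℚ_) (+-identityʳ q)
        (+-monoʳ-< q (neg-antimono-< (positive⁻¹ 1ℚ)))
  ; proper     = q , <-irrefl refl
  ; downClosed = <-trans
  ; noMaximum  = λ {p} p<q → let (m , p<m , m<q) = <-dense p<q in m , p<m , m<q
  }

IsSupremum IsInfimum : {I : Set} → (I → ℝ) → ℝ → Set₁
IsSupremum a s = (∀ i → a i ≤ s) × (∀ u → (∀ i → a i ≤ u) → s ≤ u)
IsInfimum  a s = (∀ i → s ≤ a i) × (∀ l → (∀ i → l ≤ a i) → l ≤ s)

-- limsup a = inf_n sup_{m ≥ n} a_m, where s n is the n-th supremum.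
IsLimsup : (ℕ → ℝ) → ℝ → Set₁
IsLimsup a l = ∃ λ (s : ℕ → ℝ) →
  (∀ n → IsSupremum (λ k → a (n + k)) (s n)) × IsInfimum s l

LeftΠ⁰₃ : ℝ → Set₁
LeftΠ⁰₃ r = Π⁰ 3 (fromℚSet (leftCut r))

ρ : {X : Pred ℕ 0ℓ} → Decidable X → (m : ℕ) .{{_ : NonZero m}} → ℚ
ρ X? m = + length (filter X? (upTo m)) / m

-- Excluded middle is what allows the elements of an arbitrary set to be
-- counted.  The k-th term is ρ_{k+1}, as ρ₀ is undefined.
IsUpperDensity : ExcludedMiddle 0ℓ → Pred ℕ 0ℓ → ℝ → Set₁
IsUpperDensity em X r =
  IsLimsup (λ k → fromℚ (ρ {X} (λ _ → em) (suc k))) r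

{-# OPTIONS --safe #-}
-- Let X be a Σ⁰₂ set with upper density r.  That the fraction of X below infinitely
-- many m exceeds q is a Π⁰₃ property of q.  It holds if q < r and fails if q > r; as it is
-- undetermined at q = r, rational r, whose cuts are computable, are treated apart.
-- Two quantifier exchanges stand in for coding finite sequences: ∀z ∃x<b commutes
-- when the matrix is antitone in z, and ∀x<b ∃w when it is monotone in w.
--
-- Conversely let the left cut of r be Π⁰₃.  For the rational i/(k+1), the statement
-- that the first k+1 instances of the definition hold for every rational
-- j/(d+1) ≤ i/(k+1) with d ≤ k is Σ⁰₂.  In the form of a limit it becomes: some stage n
-- settles (k,i), where n is unique and settling is Π⁰₁.  Let X contain the last part, of
-- proportion i/(k+1), of the block [n!,(n+1)!) whenever n settles (k,i).  If
-- i/(k+1) < r, then (k,i) is settled, so X has density close to i/(k+1) at the end of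
-- some block n ≥ k.  If q ≥ r, then almost all k settle no i/(k+1) ≥ q, so almost all
-- blocks contain elements of X in proportion at most q, and these come last in the block.
module Submission where

open import Level using (0ℓ; lift)
open import Axiom.ExcludedMiddle using (ExcludedMiddle)
open import Data.Fin using (Fin; zero; suc; #_)
open import Data.Integer as ℤ using (+_; -[1+_]; _⊖_)
import Data.Integer.Properties as ℤ
open import Data.List using ([]; _∷_; _∷ʳ_; _++_; length; filter; upTo)
open import Data.List.Properties using (upTo-∷ʳ; filter-++; length-++)
open import Data.Nat using (ℕ; zero; suc; pred; _+_; _*_; _∸_; _!; _⊔_; _<_; z≤n; s≤s; z<s; NonZero; >-nonZero) renaming (_≤_ to _≤ℕ_)
open import Data.Nat.Properties
open import Data.Nat.Tactic.RingSolver using (solve-∀)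
open import Data.Product using (∃; _×_; _,_; proj₁; proj₂)
open import Data.Rational using (ℚ; mkℚ; _/_; 0ℚ; 1ℚ) renaming (_<_ to _<ℚ_; _≤_ to _≤ℚ_)
import Data.Rational.Properties as ℚ
open import Data.Rational.Unnormalised as ℚᵘ using (mkℚᵘ)
import Data.Rational.Unnormalised.Properties as ℚᵘ
open import Data.Sum using (_⊎_; inj₁; inj₂; [_,_]′)
open import Data.Vec using (Vec; []; _∷_; lookup; head; tail; map; tabulate)
open import Data.Vec.Properties using (tabulate∘lookup; tabulate-∘)
open import Data.Vec.Relation.Binary.Pointwise.Inductive using (Pointwise; []; _∷_)
open import Data.Vec.Relation.Unary.All using (All; []; _∷_)
open import Function using (_∘_; _$_; id)
open import Function.Bundles using (_⇔_; mk⇔; Equivalence)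
open import Relation.Binary.Definitions using (tri<; tri≈; tri>)
open import Relation.Binary.PropositionalEquality using (_≡_; refl; sym; trans; cong; cong₂; subst; subst₂; module ≡-Reasoning)
open import Relation.Nullary using (¬_; Dec; yes; no; contradiction)
open import Relation.Nullary.Decidable using (decidable-stable)
open import Relation.Unary using (Pred)
open import Defs

open Equivalence using (to; from)

-- Recursive functions and computable relations

Fun : ℕ → Set
Fun n = Vec ℕ n → ℕ

Recursive : ∀ {n} → Fun n → Set
Recursive {n} f = ∃ λ (c : Rec n) → ∀ xs → c [ xs ]⇓ f xs

recursive-resp : ∀ {n} {f g : Fun n} → (∀ xs → f xs ≡ g xs) → Recursive f → Recursive g
recursive-resp eq (c , ok) = c , λ xs → subst (c [ xs ]⇓_) (eq xs) (ok xs)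

var : ∀ {n} (i : Fin n) → Recursive (λ xs → lookup xs i)
var i = proj i , λ _ → proj⇓ i

codes : ∀ {n m} {gs : Vec (Fun n) m} → All Recursive gs → Vec (Rec n) m
codes []             = []
codes ((c , _) ∷ cs) = c ∷ codes cs

codes⇓ : ∀ {n m} {gs : Vec (Fun n) m} (cs : All Recursive gs) xs →
         Pointwise (λ c y → c [ xs ]⇓ y) (codes cs) (map (_$ xs) gs)
codes⇓ []              xs = []
codes⇓ ((_ , ok) ∷ cs) xs = ok xs ∷ codes⇓ cs xs

infix 10 _⟨_⟩
_⟨_⟩ : ∀ {n m} {f : Fun m} {gs : Vec (Fun n) m} →
       Recursive f → All Recursive gs → Recursive (λ xs → f (map (_$ xs) gs))
(c , ok) ⟨ cs ⟩ = comp c (codes cs) , λ xs → comp⇓ (codes⇓ cs xs) (ok _)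

vars : ∀ {n m} (σ : Fin m → Fin n) → All Recursive (tabulate (λ i xs → lookup xs (σ i)))
vars {m = zero}  σ = []
vars {m = suc m} σ = var (σ zero) ∷ vars (λ i → σ (suc i))

rename : ∀ {n m} {f : Fun m} (σ : Fin m → Fin n) → Recursive f →
         Recursive (λ xs → f (tabulate (lookup xs ∘ σ)))
rename {f = f} σ rf =
  recursive-resp (λ xs → cong f (sym (tabulate-∘ (_$ xs) _))) (rf ⟨ vars σ ⟩)

infix 10 _⟨_∷id⟩
_⟨_∷id⟩ : ∀ {n} {f : Fun (suc n)} {g : Fun n} → Recursive f → Recursive g →
         Recursive (λ xs → f (g xs ∷ xs))
_⟨_∷id⟩ {f = f} {g} rf rg =
  recursive-resp (λ xs → cong (λ ys → f (g xs ∷ ys)) (eq xs)) (rf ⟨ rg ∷ vars id ⟩)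
  where
  eq : ∀ {n} (xs : Vec ℕ n) → map (_$ xs) (tabulate (λ i xs → lookup xs i)) ≡ xs
  eq xs = trans (sym (tabulate-∘ (_$ xs) _)) (tabulate∘lookup xs)

iter : ∀ {n} → Fun n → Fun (suc (suc n)) → ℕ → Fun n
iter f g zero    xs = f xs
iter f g (suc k) xs = g (k ∷ iter f g k xs ∷ xs)

recursive-iter : ∀ {n} {f : Fun n} {g : Fun (suc (suc n))} {b : Fun n} →
                 Recursive b → Recursive f → Recursive g → Recursive (λ xs → iter f g (b xs) xs)
recursive-iter {n} {f} {g} rb (c , okc) (d , okd) = prim ⟨ rb ∷id⟩
  where
  run : ∀ k xs → prec c d [ k ∷ xs ]⇓ iter f g k xs
  run zero    xs = prec⇓₀ (okc xs)
  run (suc k) xs = prec⇓₁ (run k xs) (okd _)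
  prim : Recursive {suc n} (λ xs → iter f g (head xs) (tail xs))
  prim = prec c d , λ { (k ∷ xs) → run k xs }

recursive-suc : ∀ {n} {f : Fun n} → Recursive f → Recursive (λ xs → suc (f xs))
recursive-suc rf = succRecursive ⟨ rf ∷ [] ⟩
  where
  succRecursive : Recursive {1} (λ xs → suc (head xs))
  succRecursive = succ , λ { (x ∷ []) → succ⇓ }

const : ∀ {n} k → Recursive {n} (λ _ → k)
const zero = zeroRecursive ⟨ [] ⟩
  where
  zeroRecursive : Recursive {0} (λ _ → 0)
  zeroRecursive = zer , λ { [] → zer⇓ }
const (suc k) = recursive-suc (const k)

recursive-pred : ∀ {n} {f : Fun n} → Recursive f → Recursive (λ xs → pred (f xs))
recursive-pred {f = f} rf = recursive-resp (λ xs → eq (f xs) xs) (recursive-iter rf (const 0) (var (# 0)))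
  where
  eq : ∀ {n} k (xs : Vec ℕ n) → iter (λ _ → 0) (λ ys → lookup ys (# 0)) k xs ≡ pred k
  eq zero    xs = refl
  eq (suc k) xs = refl

module _ {n} {f g : Fun n} (rf : Recursive f) (rg : Recursive g) where

  infixl 6 _⊕_ _⊝_

  _⊕_ : Recursive (λ xs → f xs + g xs)
  _⊕_ = recursive-resp (λ xs → eq (f xs) xs) (recursive-iter rf rg (recursive-suc (var (# 1))))
    where
    eq : ∀ k xs → iter g (λ ys → suc (lookup ys (# 1))) k xs ≡ k + g xs
    eq zero    xs = refl
    eq (suc k) xs = cong suc (eq k xs)

  _⊝_ : Recursive (λ xs → f xs ∸ g xs)
  _⊝_ = recursive-resp (λ xs → eq (g xs) xs) (recursive-iter rg rf (recursive-pred (var (# 1))))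
    where
    eq : ∀ k xs → iter f (λ ys → pred (lookup ys (# 1))) k xs ≡ f xs ∸ k
    eq zero    xs = refl
    eq (suc k) xs = trans (cong pred (eq k xs)) (pred[m∸n]≡m∸[1+n] (f xs) k)

shift₂ : ∀ {n} {f : Fun n} → Recursive f → Recursive (λ xs → f (tail (tail xs)))
shift₂ {f = f} rf =
  recursive-resp (λ { (x ∷ y ∷ xs) → cong f (tabulate∘lookup xs) }) (rename (λ i → suc (suc i)) rf)

infixl 7 _⊛_
_⊛_ : ∀ {n} {f g : Fun n} → Recursive f → Recursive g → Recursive (λ xs → f xs * g xs)
_⊛_ {f = f} {g} rf rg =
  recursive-resp (λ xs → eq (f xs) xs) (recursive-iter rf (const 0) (shift₂ rg ⊕ var (# 1)))
  where
  eq : ∀ k xs → iter (λ _ → 0) (λ ys → g (tail (tail ys)) + lookup ys (# 1)) k xs ≡ k * g xs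
  eq zero    xs = refl
  eq (suc k) xs = cong (λ v → g xs + v) (eq k xs)

recursive-! : ∀ {n} {f : Fun n} → Recursive f → Recursive (λ xs → f xs !)
recursive-! {f = f} rf =
  recursive-resp (λ xs → eq (f xs) xs) (recursive-iter rf (const 1) (recursive-suc (var (# 0)) ⊛ var (# 1)))
  where
  eq : ∀ {n} k (xs : Vec ℕ n) → iter (λ _ → 1) (λ ys → suc (lookup ys (# 0)) * lookup ys (# 1)) k xs ≡ k !
  eq zero    xs = refl
  eq (suc k) xs = cong (suc k *_) (eq k xs)

sumBelow : (ℕ → ℕ) → ℕ → ℕ
sumBelow f zero    = 0
sumBelow f (suc b) = sumBelow f b + f b

skip₁ : ∀ {n} {f : Fun (suc n)} → Recursive f → Recursive (λ xs → f (head xs ∷ tail (tail xs)))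
skip₁ {n} {f} rf =
  recursive-resp (λ { (x ∷ y ∷ xs) → cong (λ ys → f (x ∷ ys)) (tabulate∘lookup xs) }) (rename skip rf)
  where
  skip : Fin (suc n) → Fin (suc (suc n))
  skip zero    = zero
  skip (suc i) = suc (suc i)

recursive-sum : ∀ {n} {b : Fun n} {f : Fun (suc n)} → Recursive b → Recursive f →
                Recursive (λ xs → sumBelow (λ y → f (y ∷ xs)) (b xs))
recursive-sum {n} {b} {f} rb rf =
  recursive-resp (λ xs → eq (b xs) xs) (recursive-iter rb (const 0) (var (# 1) ⊕ skip₁ rf))
  where
  eq : ∀ k xs → iter (λ _ → 0) (λ ys → lookup ys (# 1) + f (head ys ∷ tail (tail ys))) k xs
              ≡ sumBelow (λ y → f (y ∷ xs)) k
  eq zero    xs = refl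
  eq (suc k) xs = cong (_+ f (k ∷ xs)) (eq k xs)

module _ {n} {R : Relation n} (cR : Computable R) where

  χ : Fun n
  χ xs with proj₂ cR xs
  ... | inj₁ _ = 1
  ... | inj₂ _ = 0

  recursive-χ : Recursive χ
  recursive-χ = proj₁ cR , run
    where
    run : ∀ xs → proj₁ cR [ xs ]⇓ χ xs
    run xs with proj₂ cR xs
    ... | inj₁ (_ , d) = d
    ... | inj₂ (_ , d) = d

  χ-spec : ∀ xs → (R xs × χ xs ≡ 1) ⊎ (¬ R xs × χ xs ≡ 0)
  χ-spec xs with proj₂ cR xs
  ... | inj₁ (r , _)  = inj₁ (r , refl)
  ... | inj₂ (¬r , _) = inj₂ (¬r , refl)

  χ-pos : ∀ xs → R xs ⇔ 0 < χ xs
  χ-pos xs with χ-spec xs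
  ... | inj₁ (r , eq)  = mk⇔ (λ _ → subst (0 <_) (sym eq) z<s) (λ _ → r)
  ... | inj₂ (¬r , eq) = mk⇔ (λ r → contradiction r ¬r) (λ pos → contradiction eq (>⇒≢ pos))

-- It is enough to exhibit a recursive function that is positive exactly on the relation: truncated
-- subtraction from 1, done twice, turns positive values into 1 and keeps 0.
positive-computable : ∀ {n} {R : Relation n} {f : Fun n} → Recursive f →
                      (∀ xs → R xs ⇔ 0 < f xs) → Computable R
positive-computable {R = R} {f} rf spec = sign (const 1 ⊝ (const 1 ⊝ rf))
  where
  sign : Recursive (λ xs → 1 ∸ (1 ∸ f xs)) → Computable R
  sign (c , ok) = c , λ xs → decide xs (f xs) (spec xs) (ok xs)
    where
    decide : ∀ xs k → R xs ⇔ 0 < k → c [ xs ]⇓ (1 ∸ (1 ∸ k)) →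
             (R xs × c [ xs ]⇓ 1) ⊎ (¬ R xs × c [ xs ]⇓ 0)
    decide xs zero    s d = inj₂ ((λ r → contradiction (to s r) λ ()) , d)
    decide xs (suc k) s d = inj₁ (from s z<s , subst (λ v → c [ xs ]⇓ (1 ∸ v)) (0∸n≡0 k) d)

-- Also serves to pass from relations stated by `lookup` to relations defined by pattern matching;
-- these agree definitionally only after the vector is split.
computable-resp : ∀ {n} {R S : Relation n} → (∀ xs → R xs ⇔ S xs) → Computable R → Computable S
computable-resp eq (c , ok) = c , λ xs → decide xs (ok xs)
  where
  decide : ∀ xs → _ → _
  decide xs (inj₁ (r , d))  = inj₁ (to (eq xs) r , d)
  decide xs (inj₂ (¬r , d)) = inj₂ (¬r ∘ from (eq xs) , d)

infix 10 _[_]ᶜ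
_[_]ᶜ : ∀ {n m} {R : Relation m} {gs : Vec (Fun n) m} →
        Computable R → All Recursive gs → Computable (λ xs → R (map (_$ xs) gs))
cR [ cs ]ᶜ = positive-computable (recursive-χ cR ⟨ cs ⟩) (λ xs → χ-pos cR _)

infix  4 _≤ᶜ_ _<ᶜ_
infixr 3 _×ᶜ_
infixr 2 _→ᶜ_

_<ᶜ_ : ∀ {n} {f g : Fun n} → Recursive f → Recursive g → Computable (λ xs → f xs < g xs)
rf <ᶜ rg = positive-computable (rg ⊝ rf) (λ xs → mk⇔ m<n⇒0<n∸m 0<n∸m⇒m<n)
  where
  0<n∸m⇒m<n : ∀ {m n} → 0 < n ∸ m → m < n
  0<n∸m⇒m<n {m} {n} pos = ≰⇒> λ n≤m → contradiction (m≤n⇒m∸n≡0 n≤m) (>⇒≢ pos)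

_≤ᶜ_ : ∀ {n} {f g : Fun n} → Recursive f → Recursive g → Computable (λ xs → f xs ≤ℕ g xs)
rf ≤ᶜ rg = computable-resp (λ xs → mk⇔ ≤-pred s≤s) (rf <ᶜ recursive-suc rg)

¬ᶜ_ : ∀ {n} {R : Relation n} → Computable R → Computable (λ xs → ¬ R xs)
¬ᶜ cR = positive-computable (const 1 ⊝ recursive-χ cR) spec
  where
  spec : ∀ xs → _ ⇔ 0 < 1 ∸ χ cR xs
  spec xs with χ cR xs | χ-spec cR xs
  ... | _ | inj₁ (r , refl)  = mk⇔ (λ ¬r → contradiction r ¬r) λ ()
  ... | _ | inj₂ (¬r , refl) = mk⇔ (λ _ → z<s) (λ _ → ¬r)

_×ᶜ_ : ∀ {n} {R S : Relation n} → Computable R → Computable S → Computable (λ xs → R xs × S xs)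
cR ×ᶜ cS = positive-computable (recursive-χ cR ⊛ recursive-χ cS) spec
  where
  spec : ∀ xs → _ ⇔ 0 < χ cR xs * χ cS xs
  spec xs with χ cR xs | χ-spec cR xs | χ cS xs | χ-spec cS xs
  ... | _ | inj₁ (r , refl)  | _ | inj₁ (s , refl)  = mk⇔ (λ _ → z<s) (λ _ → r , s)
  ... | _ | inj₁ (r , refl)  | _ | inj₂ (¬s , refl) = mk⇔ (λ (_ , s) → contradiction s ¬s) λ ()
  ... | _ | inj₂ (¬r , refl) | _ | _                = mk⇔ (λ (r , _) → contradiction r ¬r) λ ()

_→ᶜ_ : ∀ {n} {R S : Relation n} → Computable R → Computable S → Computable (λ xs → R xs → S xs)
cR →ᶜ cS = computable-resp spec (¬ᶜ (cR ×ᶜ ¬ᶜ cS))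
  where
  spec : ∀ xs → _ ⇔ _
  spec xs with χ-spec cS xs
  ... | inj₁ (s , _)  = mk⇔ (λ _ _ → s) (λ _ (_ , ¬s) → ¬s s)
  ... | inj₂ (¬s , _) = mk⇔ (λ h r → contradiction (r , ¬s) h) (λ h (r , ¬s) → ¬s (h r))

-- The bridge from bounded quantifiers to primitive recursion: a sum acts as a finite disjunction.
sumBelow-pos : ∀ f b → (∃ λ y → y < b × 0 < f y) ⇔ 0 < sumBelow f b
sumBelow-pos f b = mk⇔ (λ (y , y<b , pos) → intro b y<b pos) (elim b)
  where
  intro : ∀ b {y} → y < b → 0 < f y → 0 < sumBelow f b
  intro (suc b) {y} y<1+b pos with m<1+n⇒m<n∨m≡n y<1+b
  ... | inj₁ y<b  = <-≤-trans (intro b y<b pos) (m≤m+n _ _)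
  ... | inj₂ refl = <-≤-trans pos (m≤n+m _ _)
  elim : ∀ b → 0 < sumBelow f b → ∃ λ y → y < b × 0 < f y
  elim (suc b) pos with sumBelow f b in eq | f b in eq′
  ... | suc _ | _     = let (y , y<b , p) = elim b (subst (0 <_) (sym eq) z<s) in y , m<n⇒m<1+n y<b , p
  ... | zero  | suc _ = b , n<1+n b , subst (0 <_) (sym eq′) z<s
  ... | zero  | zero  = contradiction pos λ ()

∃<ᶜ : ∀ {n} {b : Fun n} {R : Relation (suc n)} → Recursive b → Computable R →
      Computable (λ xs → ∃ λ y → y < b xs × R (y ∷ xs))
∃<ᶜ {b = b} rb cR = positive-computable (recursive-sum rb (recursive-χ cR)) λ xs → mk⇔
  (λ (y , y<b , r) → to (sumBelow-pos _ (b xs)) (y , y<b , to (χ-pos cR _) r))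
  (λ pos → let (y , y<b , p) = from (sumBelow-pos _ (b xs)) pos in y , y<b , from (χ-pos cR _) p)

∀<ᶜ : ∀ {n} {b : Fun n} {R : Relation (suc n)} → Recursive b → Computable R →
      Computable (λ xs → ∀ y → y < b xs → R (y ∷ xs))
∀<ᶜ {b = b} {R} rb cR = computable-resp spec (¬ᶜ ∃<ᶜ rb (¬ᶜ cR))
  where
  spec : ∀ xs → _ ⇔ _
  spec xs = mk⇔ all (λ h (y , y<b , ¬r) → ¬r (h y y<b))
    where
    all : ¬ (∃ λ y → y < b xs × ¬ R (y ∷ xs)) → ∀ y → y < b xs → R (y ∷ xs)
    all h y y<b with χ-spec cR (y ∷ xs)
    ... | inj₁ (r , _)  = r
    ... | inj₂ (¬r , _) = contradiction (y , y<b , ¬r) h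

-- Rationals as fractions

-- Adding `y + v` to both sides clears both differences. Comparisons of rationals thus become
-- comparisons of natural numbers, which are computable.
⊖-<⇔ : ∀ x y u v → x ⊖ y ℤ.< u ⊖ v ⇔ x + v < u + y
⊖-<⇔ x y u v = mk⇔
  (λ lt → ℤ.drop‿+<+ (subst₂ ℤ._<_ (eqˡ x y v) eqʳ (ℤ.+-monoˡ-< (+ (y + v)) lt)))
  (λ lt → ℤ.≰⇒> λ ge → <⇒≱ lt (ℤ.drop‿+≤+ (subst₂ ℤ._≤_ eqʳ (eqˡ x y v) (ℤ.+-monoˡ-≤ (+ (y + v)) ge))))
  where
  open ≡-Reasoning
  eqˡ : ∀ x y v → x ⊖ y ℤ.+ + (y + v) ≡ + (x + v)
  eqˡ x y v = begin
    x ⊖ y ℤ.+ + (y + v)       ≡⟨ ℤ.distribˡ-⊖-+-pos (y + v) x y ⟩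
    (x + (y + v)) ⊖ y         ≡⟨ cong₂ _⊖_ (swap x y v) (sym (+-identityʳ y)) ⟩
    (y + (x + v)) ⊖ (y + 0)   ≡⟨ ℤ.+-cancelˡ-⊖ y (x + v) 0 ⟩
    + (x + v)                 ∎
    where
    swap : ∀ x y v → x + (y + v) ≡ y + (x + v)
    swap = solve-∀
  eqʳ : u ⊖ v ℤ.+ + (y + v) ≡ + (u + y)
  eqʳ = trans (cong (λ w → u ⊖ v ℤ.+ + w) (+-comm y v)) (eqˡ u v y)

⊖-*-+ : ∀ a b k → (a ⊖ b) ℤ.* + k ≡ a * k ⊖ b * k
⊖-*-+ a b k = begin
  (a ⊖ b) ℤ.* + k                            ≡⟨ cong (ℤ._* + k) (ℤ.m-n≡m⊖n a b) ⟨
  (+ a ℤ.+ ℤ.- (+ b)) ℤ.* + k                ≡⟨ ℤ.*-distribʳ-+ (+ k) (+ a) (ℤ.- (+ b)) ⟩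
  + a ℤ.* + k ℤ.+ ℤ.- (+ b) ℤ.* + k          ≡⟨ cong₂ ℤ._+_ (sym (ℤ.pos-* a k)) (sym (ℤ.neg-distribˡ-* (+ b) (+ k))) ⟩
  + (a * k) ℤ.+ ℤ.- (+ b ℤ.* + k)            ≡⟨ cong (λ w → + (a * k) ℤ.+ ℤ.- w) (sym (ℤ.pos-* b k)) ⟩
  + (a * k) ℤ.+ ℤ.- (+ (b * k))              ≡⟨ ℤ.m-n≡m⊖n (a * k) (b * k) ⟩
  a * k ⊖ b * k                              ∎
  where open ≡-Reasoning

-- `_/_` reduces to lowest terms. The unnormalised fractions keep the given numerators and
-- denominators, and are ordered by cross multiplication.
/-<⇔ : ∀ i d j e → i / suc d <ℚ j / suc e ⇔ i ℤ.* + suc e ℤ.< j ℤ.* + suc d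
/-<⇔ i d j e = mk⇔
  (λ lt → ℚᵘ.drop-*<* (ℚᵘ.<-respˡ-≃ (ℚ.toℚᵘ-fromℚᵘ (mkℚᵘ i d))
                      (ℚᵘ.<-respʳ-≃ (ℚ.toℚᵘ-fromℚᵘ (mkℚᵘ j e)) (ℚ.toℚᵘ-mono-< lt))))
  (λ lt → ℚ.toℚᵘ-cancel-< (ℚᵘ.<-respˡ-≃ (ℚᵘ.≃-sym (ℚ.toℚᵘ-fromℚᵘ (mkℚᵘ i d)))
                          (ℚᵘ.<-respʳ-≃ (ℚᵘ.≃-sym (ℚ.toℚᵘ-fromℚᵘ (mkℚᵘ j e))) (ℚᵘ.*<* lt))))

⊖/-<⇔ : ∀ a b d c e m → (a ⊖ b) / suc d <ℚ (c ⊖ e) / suc m ⇔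
        a * suc m + e * suc d < c * suc d + b * suc m
⊖/-<⇔ a b d c e m = mk⇔ (to cross ∘ to fractions) (from fractions ∘ from cross)
  where
  fractions : (a ⊖ b) / suc d <ℚ (c ⊖ e) / suc m ⇔ a * suc m ⊖ b * suc m ℤ.< c * suc d ⊖ e * suc d
  fractions = subst₂ (λ u v → (a ⊖ b) / suc d <ℚ (c ⊖ e) / suc m ⇔ u ℤ.< v)
                     (⊖-*-+ a b (suc m)) (⊖-*-+ c e (suc d)) (/-<⇔ (a ⊖ b) d (c ⊖ e) m)
  cross : a * suc m ⊖ b * suc m ℤ.< c * suc d ⊖ e * suc d ⇔ a * suc m + e * suc d < c * suc d + b * suc m
  cross = ⊖-<⇔ (a * suc m) (b * suc m) (c * suc d) (e * suc d)

⊖/-<+/⇔ : ∀ a b d c m → (a ⊖ b) / suc d <ℚ + c / suc m ⇔ a * suc m < c * suc d + b * suc m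
⊖/-<+/⇔ a b d c m = subst (λ v → (a ⊖ b) / suc d <ℚ + c / suc m ⇔ v < c * suc d + b * suc m)
                          (+-identityʳ (a * suc m)) (⊖/-<⇔ a b d c 0 m)

+/-<+/⇔ : ∀ a d c m → + a / suc d <ℚ + c / suc m ⇔ a * suc m < c * suc d
+/-<+/⇔ a d c m = subst (λ v → + a / suc d <ℚ + c / suc m ⇔ a * suc m < v)
                        (+-identityʳ (c * suc d)) (⊖/-<+/⇔ a 0 d c m)

⊖/-surjective : ∀ q → ∃ λ a → ∃ λ b → ∃ λ d → q ≡ (a ⊖ b) / suc d
⊖/-surjective q@(mkℚ (+ a) d _)    = a , 0 , d , sym (ℚ.↥p/↧p≡p q)
⊖/-surjective q@(mkℚ -[1+ b ] d _) = 0 , suc b , d , sym (ℚ.↥p/↧p≡p q)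

negative⊎+/ : ∀ q → q <ℚ 0ℚ ⊎ ∃ λ a → ∃ λ d → q ≡ + a / suc d
negative⊎+/ q@(mkℚ (+ a) d _)    = inj₂ (a , d , sym (ℚ.↥p/↧p≡p q))
negative⊎+/ q@(mkℚ -[1+ b ] d _) = inj₁ (ℚ.negative⁻¹ q)

-- Limits superior of rational sequences

module _ (x : ℕ → ℚ) (bounded : ∃ λ B → ∀ k → ¬ B <ℚ x k) where

  tailSup : ℕ → ℝ
  tailSup n = record
    { leftCut    = λ p → ∃ λ k → p <ℚ x (n + k)
    ; inhabited  = let q , q< = ℝ.inhabited (fromℚ (x (n + 0))) in q , 0 , q<
    ; proper     = proj₁ bounded , λ (k , B<) → proj₂ bounded (n + k) B<
    ; downClosed = λ p<q (k , q<) → k , ℚ.<-trans p<q q<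
    ; noMaximum  = λ (k , p<) → let m , p<m , m< = ℚ.<-dense p< in m , p<m , k , m<
    }

  tailSup-isSupremum : ∀ n → IsSupremum (λ k → fromℚ (x (n + k))) (tailSup n)
  tailSup-isSupremum n = (λ k p< → k , p<) , λ u ub (k , p<) → ub k p<

  -- The first hypothesis puts r below every tail supremum. As to the second, a p in a lower bound l
  -- but outside r would have some q > p still in l, hence below every tail supremum; this is why
  -- the gap p < q may be granted.
  isLimsup-intro : (r : ℝ) →
    (∀ q → leftCut r q → ∀ n → ∃ λ k → q <ℚ x (n + k)) →
    (∀ p q → ¬ leftCut r p → p <ℚ q → ∃ λ n → ∀ k → ¬ q <ℚ x (n + k)) →
    ExcludedMiddle 0ℓ → IsLimsup (λ k → fromℚ (x k)) r
  isLimsup-intro r often eventually em =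
    tailSup , tailSup-isSupremum , (λ n {q} q<r → often q q<r n) , greatest
    where
    greatest : ∀ l → (∀ n → l ≤ tailSup n) → l ≤ r
    greatest l lb {p} p<l with em {leftCut r p}
    ... | yes p<r = p<r
    ... | no  p≮r =
      let q , p<q , q<l = ℝ.noMaximum l p<l
          n , small     = eventually p q p≮r p<q
          k , q<        = lb n q<l
      in contradiction q< (small k)

  -- `IsLimsup` leaves the suprema `s n` unspecified; being least, they lie below `tailSup n`, whose
  -- cut yields an explicit index.
  isLimsup⇒often : ∀ {r} → IsLimsup (λ k → fromℚ (x k)) r →
                   ∀ {q} → leftCut r q → ∀ n → ∃ λ k → q <ℚ x (n + k)
  isLimsup⇒often (s , sup , lower , _) q<r n =
    proj₂ (sup n) (tailSup n) (proj₁ (tailSup-isSupremum n)) (lower n q<r)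

  often⇒below-limsup : ∀ {r} → IsLimsup (λ k → fromℚ (x k)) r →
                       ∀ {q} → (∀ n → ∃ λ k → q <ℚ x (n + k)) → fromℚ q ≤ r
  often⇒below-limsup (s , sup , _ , greatest) {q} often =
    greatest (fromℚ q) λ n p<q → let k , q< = often n in proj₁ (sup n) k (ℚ.<-trans p<q q<)

-- Counting elements and partial densities

module _ (em : ExcludedMiddle 0ℓ) where

  indicator : Set → ℕ
  indicator P with em {P}
  ... | yes _ = 1
  ... | no  _ = 0

  count : Pred ℕ 0ℓ → ℕ → ℕ
  count X zero    = 0
  count X (suc m) = count X m + indicator (X m)

  indicator-yes : ∀ {P} → P → indicator P ≡ 1
  indicator-yes {P} p with em {P}
  ... | yes _ = refl
  ... | no ¬p = contradiction p ¬p

  indicator-no : ∀ {P} → ¬ P → indicator P ≡ 0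
  indicator-no {P} ¬p with em {P}
  ... | yes p = contradiction p ¬p
  ... | no _  = refl

  indicator-≤1 : ∀ P → indicator P ≤ℕ 1
  indicator-≤1 P with em {P}
  ... | yes _ = s≤s z≤n
  ... | no  _ = z≤n

  indicator-mono : ∀ {P Q} → (P → Q) → indicator P ≤ℕ indicator Q
  indicator-mono {P} {Q} f with em {P}
  ... | yes p = ≤-reflexive (sym (indicator-yes (f p)))
  ... | no  _ = z≤n

  count-∈ : ∀ {X m} → X m → count X (suc m) ≡ suc (count X m)
  count-∈ {X} {m} x = trans (cong (λ v → count X m + v) (indicator-yes x)) (+-comm (count X m) 1)

  count-∉ : ∀ {X m} → ¬ X m → count X (suc m) ≡ count X m
  count-∉ {X} {m} ¬x = trans (cong (λ v → count X m + v) (indicator-no ¬x)) (+-identityʳ (count X m))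

  count-≤ : ∀ X m → count X m ≤ℕ m
  count-≤ X zero    = z≤n
  count-≤ X (suc m) = subst (count X (suc m) ≤ℕ_) (+-comm m 1) (+-mono-≤ (count-≤ X m) (indicator-≤1 (X m)))

  count-mono : ∀ {X Y} m → (∀ j → j < m → X j → Y j) → count X m ≤ℕ count Y m
  count-mono zero    X⊆Y = z≤n
  count-mono (suc m) X⊆Y =
    +-mono-≤ (count-mono m (λ j j<m → X⊆Y j (m<n⇒m<1+n j<m))) (indicator-mono (X⊆Y m (n<1+n m)))

  length-filter : ∀ X m → length (filter {P = X} (λ _ → em) (upTo m)) ≡ count X m
  length-filter X zero    = refl
  length-filter X (suc m) = begin
    length (filter X? (upTo (suc m)))                       ≡⟨ cong (length ∘ filter X?) (upTo-∷ʳ m) ⟨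
    length (filter X? (upTo m ∷ʳ m))                        ≡⟨ cong length (filter-++ X? (upTo m) (m ∷ [])) ⟩
    length (filter X? (upTo m) ++ filter X? (m ∷ []))       ≡⟨ length-++ (filter X? (upTo m)) ⟩
    length (filter X? (upTo m)) + length (filter X? (m ∷ [])) ≡⟨ cong₂ _+_ (length-filter X m) last ⟩
    count X (suc m)                                         ∎
    where
    open ≡-Reasoning
    X? : ∀ j → Dec (X j)
    X? _ = em
    last : length (filter X? (m ∷ [])) ≡ indicator (X m)
    last with em {X m}
    ... | yes _ = refl
    ... | no  _ = refl

  ρ-count : ∀ X k → ρ {X} (λ _ → em) (suc k) ≡ + count X (suc k) / suc k
  ρ-count X k = cong (λ v → + v / suc k) (length-filter X (suc k))

  ρ-≮1 : ∀ X k → ¬ + 1 / 1 <ℚ ρ {X} (λ _ → em) (suc k)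
  ρ-≮1 X k 1<ρ = <⇒≱ (to (+/-<+/⇔ 1 0 (count X (suc k)) k) (subst (+ 1 / 1 <ℚ_) (ρ-count X k) 1<ρ))
    (subst₂ _≤ℕ_ (sym (*-identityʳ _)) (sym (*-identityˡ _)) (count-≤ X (suc k)))

  ρ-≥0 : ∀ X k → 0ℚ ≤ℚ ρ {X} (λ _ → em) (suc k)
  ρ-≥0 X k = ℚ.≮⇒≥ λ ρ<0 → contradiction
    (to (+/-<+/⇔ (count X (suc k)) k 0 0) (subst (_<ℚ 0ℚ) (ρ-count X k) ρ<0)) λ ()

  below-ρ⇔ : ∀ a b d X k → (a ⊖ b) / suc d <ℚ ρ {X} (λ _ → em) (suc k) ⇔
             a * suc k < count X (suc k) * suc d + b * suc k
  below-ρ⇔ a b d X k = subst (λ v → (a ⊖ b) / suc d <ℚ v ⇔ a * suc k < count X (suc k) * suc d + b * suc k)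
                             (sym (ρ-count X k)) (⊖/-<+/⇔ a b d (count X (suc k)) k)

  -- Quantifier exchanges

  ∀⊎∃¬ : ∀ (P : ℕ → Set) → (∀ z → P z) ⊎ ∃ λ z → ¬ P z
  ∀⊎∃¬ P with em {∃ λ z → ¬ P z}
  ... | yes ex = inj₂ ex
  ... | no ¬ex = inj₁ stable
    where
    stable : ∀ z → P z
    stable z with em {P z}
    ... | yes p = p
    ... | no ¬p = contradiction (z , ¬p) ¬ex

  -- Induction on b. If the candidate b fails at some z₀, it fails from z₀ on by antitonicity; the
  -- witness for the maximum of z₀ and z is then below b, and serves for z as well.
  ∃<∀-commute : ∀ {P : ℕ → ℕ → Set} b → (∀ {x z z′} → z ≤ℕ z′ → P x z′ → P x z) →
                (∀ z → ∃ λ x → x < b × P x z) → ∃ λ x → x < b × ∀ z → P x z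
  ∃<∀-commute {P} zero    anti h with () ← proj₁ (proj₂ (h 0))
  ∃<∀-commute {P} (suc b) anti h with ∀⊎∃¬ (P b)
  ... | inj₁ all      = b , n<1+n b , all
  ... | inj₂ (z₀ , ¬p) = let x , x<b , all = ∃<∀-commute b anti below in x , m<n⇒m<1+n x<b , all
    where
    below : ∀ z → ∃ λ x → x < b × P x z
    below z with h (z₀ ⊔ z)
    ... | x , x<1+b , p with m<1+n⇒m<n∨m≡n x<1+b
    ...   | inj₁ x<b  = x , x<b , anti (m≤n⊔m z₀ z) p
    ...   | inj₂ refl = contradiction (anti (m≤m⊔n z₀ z) p) ¬p

-- By monotonicity the maximum of the finitely many witnesses serves throughout.
∀<∃-commute : ∀ {P : ℕ → ℕ → Set} b → (∀ {x w w′} → w ≤ℕ w′ → P x w → P x w′) →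
              (∀ x → x < b → ∃ λ w → P x w) → ∃ λ w → ∀ x → x < b → P x w
∀<∃-commute zero    mono h = 0 , λ _ ()
∀<∃-commute {P} (suc b) mono h = w ⊔ v , all
  where
  w = proj₁ (∀<∃-commute {P} b mono (λ x x<b → h x (m<n⇒m<1+n x<b)))
  v = proj₁ (h b (n<1+n b))
  all : ∀ x → x < suc b → P x (w ⊔ v)
  all x x<1+b with m<1+n⇒m<n∨m≡n x<1+b
  ... | inj₁ x<b  = mono (m≤m⊔n w v) (proj₂ (∀<∃-commute {P} b mono (λ x x<b → h x (m<n⇒m<1+n x<b))) x x<b)
  ... | inj₂ refl = mono (m≤n⊔m w v) (proj₂ (h b (n<1+n b)))

-- Upper densities of Σ⁰₂ sets

Π⁰₃-intro : ∀ {n} {R : Relation n} {S : Relation (suc (suc (suc n)))} → Computable S →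
            (∀ xs → R xs ⇔ (∀ x → ∃ λ y → ∀ z → S (z ∷ y ∷ x ∷ xs))) → Π⁰ 3 R
Π⁰₃-intro {S = S} cS spec =
  (λ xs → ∃ λ y → ∀ z → S (z ∷ y ∷ xs)) ,
  ((λ xs → ∀ z → S (z ∷ xs)) , (S , lift cS , λ _ → mk⇔ id id) , λ _ → mk⇔ id id) ,
  spec

Π⁰₃-elim : ∀ {n} {R : Relation n} → Π⁰ 3 R → ∃ λ (S : Relation (suc (suc (suc n)))) →
           Computable S × (∀ xs → R xs ⇔ (∀ x → ∃ λ y → ∀ z → S (z ∷ y ∷ x ∷ xs)))
Π⁰₃-elim (_ , (_ , (S , lift cS , eq₁) , eq₂) , eq₃) = S , cS , λ xs → mk⇔
  (λ r x → let y , s = to (eq₂ _) (to (eq₃ xs) r x) in y , to (eq₁ _) s)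
  (λ h → from (eq₃ xs) λ x → let y , s = h x in from (eq₂ _) (y , from (eq₁ _) s))

Σ⁰₂-elim : ∀ {n} {R : Relation n} → Σ⁰ 2 R → ∃ λ (S : Relation (suc (suc n))) →
           Computable S × (∀ xs → R xs ⇔ (∃ λ y → ∀ z → S (z ∷ y ∷ xs)))
Σ⁰₂-elim (_ , (S , lift cS , eq₁) , eq₂) = S , cS , λ xs → mk⇔
  (λ r → let y , s = to (eq₂ xs) r in y , to (eq₁ _) s)
  (λ (y , s) → from (eq₂ xs) (y , from (eq₁ _) s))

-- A vacuous existential quantifier is put in front.
Π⁰₁⇒Σ⁰₂ : ∀ {n} {R : Relation n} → Π⁰ 1 R → Σ⁰ 2 R
Π⁰₁⇒Σ⁰₂ {R = R} (S , lift cS , eq) =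
  (λ xs → R (tail xs)) ,
  ((λ xs → S (head xs ∷ tail (tail xs))) , lift cS′ , λ { (y ∷ xs) → eq xs }) ,
  λ xs → mk⇔ (λ r → 0 , r) proj₂
  where
  cS′ : Computable (λ xs → S (head xs ∷ tail (tail xs)))
  cS′ = positive-computable (skip₁ (recursive-χ cS)) (λ xs → χ-pos cS _)

module _ (em : ExcludedMiddle 0ℓ) where

  -- On a computable relation, counting by excluded middle agrees with summing the characteristic
  -- function.
  recursive-count : ∀ {n} {b : Fun n} {R : Relation (suc n)} → Recursive b → Computable R →
                    Recursive (λ xs → count em (λ j → R (j ∷ xs)) (b xs))
  recursive-count {b = b} {R} rb cR =
    recursive-resp (λ xs → sum≡count xs (b xs)) (recursive-sum rb (recursive-χ cR))
    where
    sum≡count : ∀ xs m → sumBelow (λ j → χ cR (j ∷ xs)) m ≡ count em (λ j → R (j ∷ xs)) m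
    sum≡count xs zero    = refl
    sum≡count xs (suc m) = cong₂ _+_ (sum≡count xs m) χ≡indicator
      where
      χ≡indicator : χ cR (m ∷ xs) ≡ indicator em (R (m ∷ xs))
      χ≡indicator with χ-spec cR (m ∷ xs)
      ... | inj₁ (r , eq)  = trans eq (sym (indicator-yes em r))
      ... | inj₂ (¬r , eq) = trans eq (sym (indicator-no em ¬r))

  -- The inequality (a - b) / (d + 1) < `count (suc k)` / (k + 1), with denominators and subtraction
  -- cleared.
  Exceeds : (count : ℕ → ℕ) (a b d k : ℕ) → Set
  Exceeds count a b d k = a * suc k < count (suc k) * suc d + b * suc k

  Exceeds-mono : ∀ {f g : ℕ → ℕ} a b d k → f (suc k) ≤ℕ g (suc k) → Exceeds f a b d k → Exceeds g a b d k
  Exceeds-mono a b d k f≤g lt = <-≤-trans lt (+-monoˡ-≤ (b * suc k) (*-monoˡ-≤ (suc d) f≤g))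

  module _ {X : Pred ℕ 0ℓ} (S : Relation 3) (cS : Computable S)
           (X⇔ : ∀ j → X j ⇔ (∃ λ y → ∀ z → S (z ∷ y ∷ j ∷ []))) where

    -- A computable approximation to X: p bounds the existential quantifier and z the universal one.
    -- It grows with p and shrinks with z.
    Approx : ℕ → ℕ → Pred ℕ 0ℓ
    Approx z p j = ∃ λ y → y < p × ∀ z′ → z′ < z → S (z′ ∷ y ∷ j ∷ [])

    Approx-anti : ∀ {z z′ p j} → z ≤ℕ z′ → Approx z′ p j → Approx z p j
    Approx-anti z≤z′ (y , y<p , h) = y , y<p , λ v v<z → h v (<-≤-trans v<z z≤z′)

    -- Beyond one witness for each of the finitely many elements of X below m, a bound p never loses
    -- any of them.
    Approx-complete : ∀ m → ∃ λ p → ∀ j → j < m → X j → ∀ z → Approx z p j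
    Approx-complete m = ∀<∃-commute m mono witness
      where
      mono : ∀ {j p p′} → p ≤ℕ p′ → (X j → ∀ z → Approx z p j) → X j → ∀ z → Approx z p′ j
      mono p≤p′ h x z = let y , y<p , s = h x z in y , <-≤-trans y<p p≤p′ , s
      witness : ∀ j → j < m → ∃ λ p → X j → ∀ z → Approx z p j
      witness j _ with em {X j}
      ... | no ¬x = 0 , λ x → contradiction x ¬x
      ... | yes x = let y , s = to (X⇔ j) x in suc y , λ _ z → y , n<1+n y , λ z′ _ → s z′

    -- If j survives all z, one of the finitely many y < p works for every z, so j is in X.
    -- Otherwise j is discarded at some z, and the maximum over j < m discards all such j.
    Approx-sound : ∀ m p → ∃ λ z → ∀ j → j < m → Approx z p j → X j
    Approx-sound m p = ∀<∃-commute m (λ z≤z′ h s → h (Approx-anti z≤z′ s)) witness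
      where
      witness : ∀ j → j < m → ∃ λ z → Approx z p j → X j
      witness j _ with ∀⊎∃¬ em (λ z → Approx z p j)
      ... | inj₂ (z , ¬s) = z , λ s → contradiction s ¬s
      ... | inj₁ all      = 0 , λ _ →
        let y , _ , s = ∃<∀-commute em p (λ z≤z′ h v v<z → h v (<-≤-trans v<z z≤z′)) all
        -- `Approx z` tests only arguments below z, so the instance z is read off at `suc z`.
        in from (X⇔ j) (y , λ z → s (suc z) z (n<1+n z))

    -- The one bound p serves both for k and for the witnesses behind the count, so that a single
    -- quantifier over p remains outside.
    ApproxExceeds : (z p n a b d : ℕ) → Set
    ApproxExceeds z p n a b d = ∃ λ k → k < p × n ≤ℕ k × Exceeds (count em (Approx z p)) a b d k

    ApproxExceedsᴿ : Relation 6
    ApproxExceedsᴿ (z ∷ p ∷ n ∷ a ∷ b ∷ d ∷ []) = ApproxExceeds z p n a b d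

    ApproxExceeds-computable : Computable ApproxExceedsᴿ
    ApproxExceeds-computable = computable-resp {S = ApproxExceedsᴿ} (λ { (z ∷ p ∷ n ∷ a ∷ b ∷ d ∷ []) → mk⇔ id id })
      (∃<ᶜ (var (# 1)) (var (# 3) ≤ᶜ var (# 0) ×ᶜ
        var (# 4) ⊛ recursive-suc (var (# 0)) <ᶜ
        recursive-count (recursive-suc (var (# 0)))
          (∃<ᶜ (var (# 3)) (∀<ᶜ (var (# 3)) (cS [ var (# 0) ∷ var (# 1) ∷ var (# 2) ∷ [] ]ᶜ)))
          ⊛ recursive-suc (var (# 6)) ⊕ var (# 5) ⊛ recursive-suc (var (# 0))))

    -- Forwards, p is taken beyond k and beyond the witnesses for X up to k. Backwards, the exchange
    -- fixes one k for all z, and a z large enough makes the approximation sound up to k.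
    Exceeds⇔ : ∀ n a b d → (∃ λ k → n ≤ℕ k × Exceeds (count em X) a b d k) ⇔
               (∃ λ p → ∀ z → ApproxExceeds z p n a b d)
    Exceeds⇔ n a b d = mk⇔ approximate limit
      where
      approximate : (∃ λ k → n ≤ℕ k × Exceeds (count em X) a b d k) → ∃ λ p → ∀ z → ApproxExceeds z p n a b d
      approximate (k , n≤k , ex) with Approx-complete (suc k)
      ... | p , complete = p ⊔ suc k , λ z → k , m≤n⊔m p (suc k) , n≤k ,
        Exceeds-mono {count em X} {count em (Approx z (p ⊔ suc k))} a b d k
          (count-mono em (suc k) λ j j<1+k x → enlarge (complete j j<1+k x z)) ex
        where
        enlarge : ∀ {z j} → Approx z p j → Approx z (p ⊔ suc k) j
        enlarge (y , y<p , s) = y , <-≤-trans y<p (m≤m⊔n p (suc k)) , s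
      limit : (∃ λ p → ∀ z → ApproxExceeds z p n a b d) → ∃ λ k → n ≤ℕ k × Exceeds (count em X) a b d k
      limit (p , h) with ∃<∀-commute em p anti h
        where
        anti : ∀ {k z z′} → z ≤ℕ z′ → n ≤ℕ k × Exceeds (count em (Approx z′ p)) a b d k →
               n ≤ℕ k × Exceeds (count em (Approx z p)) a b d k
        anti {k} {z} {z′} z≤z′ (n≤k , ex) = n≤k ,
          Exceeds-mono {count em (Approx z′ p)} {count em (Approx z p)} a b d k
            (count-mono em (suc k) λ j _ → Approx-anti z≤z′) ex
      ... | k , _ , all with Approx-sound (suc k) p
      ...   | z , sound = k , proj₁ (all z) ,
        Exceeds-mono {count em (Approx z p)} {count em X} a b d k
          (count-mono em (suc k) sound) (proj₂ (all z))

  -- The cut of a rational is computable, so all three quantifiers are vacuous.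
  rational-LeftΠ⁰₃ : ∀ {r} q → (∀ p → leftCut r p ⇔ p <ℚ q) → LeftΠ⁰₃ r
  rational-LeftΠ⁰₃ q cut with ⊖/-surjective q
  ... | c , e , m , refl = Π⁰₃-intro computable
    λ { (a ∷ b ∷ d ∷ []) → mk⇔
      (λ p<r x → 0 , λ z → to (⊖/-<⇔ a b d c e m) (to (cut _) p<r))
      (λ h → from (cut _) (from (⊖/-<⇔ a b d c e m) (proj₂ (h 0) 0))) }
    where
    Below : Relation 6
    Below (z ∷ y ∷ x ∷ a ∷ b ∷ d ∷ []) = a * suc m + e * suc d < c * suc d + b * suc m
    computable : Computable Below
    computable = computable-resp {S = Below} (λ { (z ∷ y ∷ x ∷ a ∷ b ∷ d ∷ []) → mk⇔ id id })
      (var (# 3) ⊛ const (suc m) ⊕ const e ⊛ recursive-suc (var (# 5)) <ᶜ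
       const c ⊛ recursive-suc (var (# 5)) ⊕ var (# 4) ⊛ const (suc m))

  module _ {X : Pred ℕ 0ℓ} {r : ℝ} (lim : IsUpperDensity em X r) where

    InfinitelyOften : (a b d : ℕ) → Set
    InfinitelyOften a b d = ∀ n → ∃ λ k → n ≤ℕ k × Exceeds (count em X) a b d k

    private
      x : ℕ → ℚ
      x k = ρ {X} (λ _ → em) (suc k)
      bounded : ∃ λ B → ∀ k → ¬ B <ℚ x k
      bounded = + 1 / 1 , ρ-≮1 em X

    below⇒infinitelyOften : ∀ a b d → leftCut r ((a ⊖ b) / suc d) → InfinitelyOften a b d
    below⇒infinitelyOften a b d q<r n =
      let k , q< = isLimsup⇒often x bounded {r} lim q<r n
      in n + k , m≤m+n n k , to (below-ρ⇔ em a b d X (n + k)) q<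

    infinitelyOften⇒≤ : ∀ a b d → InfinitelyOften a b d → fromℚ ((a ⊖ b) / suc d) ≤ r
    infinitelyOften⇒≤ a b d h = often⇒below-limsup x bounded {r} lim λ n →
      let k , n≤k , ex = h n
      in k ∸ n , subst (λ k → (a ⊖ b) / suc d <ℚ x k) (sym (m+[n∸m]≡n n≤k))
                       (from (below-ρ⇔ em a b d X k) ex)

    -- The two implications leave open whether q = r itself satisfies
    -- InfinitelyOften, which matters only if r is rational.
    infinitelyOften⇔below : ¬ (∃ λ q → ¬ leftCut r q × fromℚ q ≤ r) →
                            ∀ a b d → leftCut r ((a ⊖ b) / suc d) ⇔ InfinitelyOften a b d
    infinitelyOften⇔below irrational a b d = mk⇔ (below⇒infinitelyOften a b d) cofinal
      where
      cofinal : InfinitelyOften a b d → leftCut r ((a ⊖ b) / suc d)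
      cofinal h = decidable-stable em λ q≮r → irrational (_ , q≮r , λ {p} → infinitelyOften⇒≤ a b d h {p})

  Σ⁰₂-upperDensity⇒LeftΠ⁰₃ : ∀ {X r} → Σ⁰ 2 (fromSet X) → IsUpperDensity em X r → LeftΠ⁰₃ r
  Σ⁰₂-upperDensity⇒LeftΠ⁰₃ {X} {r} σ lim with em {∃ λ q → ¬ leftCut r q × fromℚ q ≤ r}
  -- Here r is the rational q: all rationals below q are in the cut, and none from q on.
  ... | yes (q , q≮r , below) = rational-LeftΠ⁰₃ {r} q λ p → mk⇔ (under p) below
    where
    under : ∀ p → leftCut r p → p <ℚ q
    under p p<r with ℚ.<-cmp p q
    ... | tri< p<q _ _  = p<q
    ... | tri≈ _ refl _ = contradiction p<r q≮r
    ... | tri> _ _ q<p  = contradiction (ℝ.downClosed r q<p p<r) q≮r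
  ... | no irrational = Π⁰₃-intro (ApproxExceeds-computable S cS X⇔) spec
    where
    S = proj₁ (Σ⁰₂-elim σ)
    cS = proj₁ (proj₂ (Σ⁰₂-elim σ))
    X⇔ : ∀ j → X j ⇔ (∃ λ y → ∀ z → S (z ∷ y ∷ j ∷ []))
    X⇔ j = proj₂ (proj₂ (Σ⁰₂-elim σ)) (j ∷ [])
    spec : ∀ xs → fromℚSet (leftCut r) xs ⇔
                  (∀ n → ∃ λ p → ∀ z → ApproxExceedsᴿ S cS X⇔ (z ∷ p ∷ n ∷ xs))
    spec (a ∷ b ∷ d ∷ []) = mk⇔
      (λ q<r n → to (Exceeds⇔ S cS X⇔ n a b d) (to (infinitelyOften⇔below {X} {r} lim irrational a b d) q<r n))
      (λ h → from (infinitelyOften⇔below {X} {r} lim irrational a b d) λ n → from (Exceeds⇔ S cS X⇔ n a b d) (h n))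

-- Counting in factorial blocks

n!>0 : ∀ n → 0 < n !
n!>0 zero    = z<s
n!>0 (suc n) = <-≤-trans (n!>0 n) (m≤m+n (n !) (n * n !))

!-mono-≤ : ∀ {m n} → m ≤ℕ n → m ! ≤ℕ n !
!-mono-≤ {n = n} z≤n             = n!>0 n
!-mono-≤ (s≤s {m} {n} m≤n)       = *-mono-≤ (s≤s m≤n) (!-mono-≤ m≤n)

n≤n! : ∀ n → n ≤ℕ n !
n≤n! zero    = z≤n
n≤n! (suc n) = m≤m*n (suc n) (n !) {{>-nonZero (n!>0 n)}}

!-block-unique : ∀ m n {j} → m ! ≤ℕ j → j < suc m ! → n ! ≤ℕ j → j < suc n ! → m ≡ n
!-block-unique m n m!≤j j<1+m! n!≤j j<1+n! with <-cmp m n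
... | tri< m<n _ _ = contradiction (≤-trans (!-mono-≤ m<n) n!≤j) (<⇒≱ j<1+m!)
... | tri≈ _ m≡n _ = m≡n
... | tri> _ _ n<m = contradiction (≤-trans (!-mono-≤ n<m) m!≤j) (<⇒≱ j<1+n!)

module _ (em : ExcludedMiddle 0ℓ) where

  module _ {X : Pred ℕ 0ℓ} {P Q N : ℕ} (P≤Q : P ≤ℕ Q)
           (final : ∀ {n m} → N ≤ℕ n → n ! ≤ℕ m → m < suc n ! → X m →
                    Q * suc n ! ≤ℕ P * (n * n !) + m * Q) where

    private
      F = count em X

      -- In a block the elements of X come last, so F stays constant up to some
      -- point, from which on the bound is the one for the end of the block minus
      -- what is left of the block.
      Bound : ℕ → ℕ → Set
      Bound n m = Q * F m ≤ℕ P * n ! + Q * N !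
                ⊎ Q * F m + Q * suc n ! ≤ℕ P * suc n ! + Q * N ! + Q * m

      Located : ℕ → Set
      Located m = ∃ λ n → N ≤ℕ n × n ! ≤ℕ m × m ≤ℕ suc n ! × Bound n m

      bound-suc : ∀ {n m} → Dec (X m) → N ≤ℕ n → n ! ≤ℕ m → m < suc n ! → Bound n m → Bound n (suc m)
      bound-suc {n} {m} (no ¬x) N≤n n!≤m m<1+n! (inj₁ low) =
        inj₁ (subst (λ v → Q * v ≤ℕ P * n ! + Q * N !) (sym (count-∉ em {X} {m} ¬x)) low)
      bound-suc {n} {m} (no ¬x) N≤n n!≤m m<1+n! (inj₂ high) =
        inj₂ (subst (λ v → Q * v + Q * suc n ! ≤ℕ P * suc n ! + Q * N ! + Q * suc m) (sym (count-∉ em {X} {m} ¬x))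
                (≤-trans high (+-monoʳ-≤ (P * suc n ! + Q * N !) (*-monoʳ-≤ Q (n≤1+n m)))))
      bound-suc {n} {m} (yes x) N≤n n!≤m m<1+n! (inj₂ high) =
        inj₂ (subst (λ v → Q * v + Q * suc n ! ≤ℕ P * suc n ! + Q * N ! + Q * suc m) (sym (count-∈ em {X} {m} x))
                (subst₂ _≤ℕ_ (eqˡ Q (F m) (suc n !)) (eqʳ Q m (P * suc n ! + Q * N !)) (+-monoʳ-≤ Q high)))
        where
        eqˡ : ∀ Q f M → Q + (Q * f + Q * M) ≡ Q * suc f + Q * M
        eqˡ = solve-∀
        eqʳ : ∀ Q m c → Q + (c + Q * m) ≡ c + Q * suc m
        eqʳ = solve-∀
      -- Adding the inequality from `final` to the first alternative yields the second, because n! +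
      -- n · n! = (n + 1)!.
      bound-suc {n} {m} (yes x) N≤n n!≤m m<1+n! (inj₁ low) =
        inj₂ (subst (λ v → Q * v + Q * suc n ! ≤ℕ P * suc n ! + Q * N ! + Q * suc m) (sym (count-∈ em {X} {m} x)) (begin
          Q * suc (F m) + Q * suc n !                              ≡⟨ eqˡ Q (F m) (Q * suc n !) ⟩
          Q + Q * F m + Q * suc n !                                ≤⟨ +-mono-≤ (+-monoʳ-≤ Q low) (final N≤n n!≤m m<1+n! x) ⟩
          Q + (P * n ! + Q * N !) + (P * (n * n !) + m * Q)        ≡⟨ eqʳ P Q m n (n !) (Q * N !) ⟩
          P * (suc n * n !) + Q * N ! + Q * suc m                  ∎))
        where
        open ≤-Reasoning
        eqˡ : ∀ Q f c → Q * suc f + c ≡ Q + Q * f + c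
        eqˡ = solve-∀
        eqʳ : ∀ P Q m n a c → Q + (P * a + c) + (P * (n * a) + m * Q) ≡ P * (suc n * a) + c + Q * suc m
        eqʳ = solve-∀

      -- At the end of a block nothing of it is left, so the second alternative turns into the first
      -- one for the next block.
      next-block : ∀ {n} → Bound n (suc n !) → Bound (suc n) (suc n !)
      next-block {n} (inj₁ low)  = inj₁ (≤-trans low (+-monoˡ-≤ (Q * N !) (*-monoʳ-≤ P (!-mono-≤ (n≤1+n n)))))
      next-block {n} (inj₂ high) = inj₁ (+-cancelʳ-≤ (Q * suc n !) _ _ high)

      located-suc : ∀ {m} → Located m → Located (suc m)
      located-suc {m} (n , N≤n , n!≤m , m≤1+n! , bound) with m≤n⇒m<n∨m≡n m≤1+n!
      ... | inj₁ m<1+n! = n , N≤n , m≤n⇒m≤1+n n!≤m , m<1+n! , bound-suc {n} em N≤n n!≤m m<1+n! bound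
      ... | inj₂ refl   =
        suc n , m≤n⇒m≤1+n N≤n , n≤1+n (suc n !) , lt ,
        bound-suc {suc n} em (m≤n⇒m≤1+n N≤n) ≤-refl lt (next-block {n} bound)
        where
        lt : suc n ! < suc (suc n) !
        lt = m<m+n (suc n !) (<-≤-trans (n!>0 (suc n)) (m≤m+n (suc n !) (n * suc n !)))

      located : ∀ e → Located (e + N !)
      located zero    = N , ≤-refl , ≤-refl , !-mono-≤ (n≤1+n N) ,
                        inj₁ (≤-trans (*-monoʳ-≤ Q (count-≤ em X (N !))) (m≤n+m (Q * N !) (P * N !)))
      located (suc e) = located-suc (located e)

      bound⇒ : ∀ n {m} → n ! ≤ℕ m → m ≤ℕ suc n ! → Bound n m → Q * F m ≤ℕ P * m + Q * N !
      bound⇒ n n!≤m m≤1+n! (inj₁ low) = ≤-trans low (+-monoˡ-≤ (Q * N !) (*-monoʳ-≤ P n!≤m))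
      bound⇒ n {m} n!≤m m≤1+n! (inj₂ high) = +-cancelʳ-≤ (Q * suc n !) _ _ (begin
        Q * F m + Q * suc n !                             ≤⟨ high ⟩
        P * suc n ! + Q * N ! + Q * m                     ≡⟨ cong (λ M → P * M + Q * N ! + Q * m) (m+[n∸m]≡n m≤1+n!) ⟨
        -- `P≤Q` replaces P · l by Q · l, after which the l numbers left in the block cancel.
        P * (m + l) + Q * N ! + Q * m                     ≤⟨ +-monoˡ-≤ (Q * m) (+-monoˡ-≤ (Q * N !) (≤-trans (≤-reflexive (*-distribˡ-+ P m l)) (+-monoʳ-≤ (P * m) (*-monoˡ-≤ l P≤Q)))) ⟩
        P * m + Q * l + Q * N ! + Q * m                   ≡⟨ eq (P * m) Q l (Q * N !) m ⟩
        P * m + Q * N ! + Q * (m + l)                     ≡⟨ cong (λ M → P * m + Q * N ! + Q * M) (m+[n∸m]≡n m≤1+n!) ⟩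
        P * m + Q * N ! + Q * suc n !                     ∎)
        where
        open ≤-Reasoning
        l = suc n ! ∸ m
        eq : ∀ p Q l c m → p + Q * l + c + Q * m ≡ p + c + Q * (m + l)
        eq = solve-∀

    -- The constant Q · N! pays for the numbers before block N, where `final` says nothing. From
    -- there on, `Bound` is carried along number by number and weakened at the end.
    count-upper : ∀ m → N ! ≤ℕ m → Q * F m ≤ℕ P * m + Q * N !
    count-upper m N!≤m =
      let n , _ , n!≤m , m≤1+n! , bound = subst Located (m∸n+n≡m N!≤m) (located (m ∸ N !))
      in bound⇒ n n!≤m m≤1+n! bound

  -- Induction along the block: both sides of the invariant grow by k + 1 at an element of X, and
  -- outside X the contrapositive of the hypothesis gives the invariant outright. The 1 added to the
  -- count absorbs rounding.
  count-lower : ∀ {X n k i} → i ≤ℕ suc k →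
    (∀ m → n ! ≤ℕ m → m < suc n ! → suc n ! * suc k ≤ℕ i * (n * n !) + m * suc k → X m) →
    i * (n * n !) ≤ℕ suc k * suc (count em X (suc n !))
  count-lower {X} {n} {k} {i} i≤1+k final =
    +-cancelʳ-≤ (suc k * suc n !) _ _
      (subst (λ m → i * L + suc k * m ≤ℕ suc k * suc (F m) + suc k * suc n !) (+-comm L (n !)) (go L ≤-refl))
    where
    open ≤-Reasoning
    F = count em X
    L = n * n !
    go : ∀ p → p ≤ℕ L → i * L + suc k * (p + n !) ≤ℕ suc k * suc (F (p + n !)) + suc k * suc n !
    go zero _ = begin
      i * L + suc k * n !                               ≤⟨ +-monoˡ-≤ (suc k * n !) (*-monoˡ-≤ L i≤1+k) ⟩
      suc k * L + suc k * n !                           ≡⟨ eq (suc k) L (n !) ⟩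
      suc k * suc n !                                   ≤⟨ m≤n+m _ (suc k * suc (F (n !))) ⟩
      suc k * suc (F (n !)) + suc k * suc n !           ∎
      where
      eq : ∀ s l a → s * l + s * a ≡ s * (a + l)
      eq = solve-∀
    go (suc p) p<L = step em
      where
      m = p + n !
      m<1+n! : m < suc n !
      m<1+n! = subst (m <_) (+-comm L (n !)) (+-monoˡ-< (n !) p<L)
      eq₁ : ∀ c s m → c + s * suc m ≡ s + (c + s * m)
      eq₁ = solve-∀
      eq₂ : ∀ s f c → s + (s * suc f + c) ≡ s * suc (suc f) + c
      eq₂ = solve-∀
      eq₃ : ∀ c s m → c + s * suc m ≡ s + (c + m * s)
      eq₃ = solve-∀
      step : Dec (X m) → i * L + suc k * suc m ≤ℕ suc k * suc (F (suc m)) + suc k * suc n !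
      step (yes x) = begin
        i * L + suc k * suc m                             ≡⟨ eq₁ (i * L) (suc k) m ⟩
        suc k + (i * L + suc k * m)                       ≤⟨ +-monoʳ-≤ (suc k) (go p (<⇒≤ p<L)) ⟩
        suc k + (suc k * suc (F m) + suc k * suc n !)     ≡⟨ eq₂ (suc k) (F m) (suc k * suc n !) ⟩
        suc k * suc (suc (F m)) + suc k * suc n !         ≡⟨ cong (λ v → suc k * suc v + suc k * suc n !) (count-∈ em {X} {m} x) ⟨
        suc k * suc (F (suc m)) + suc k * suc n !         ∎
      step (no ¬x) = begin
        i * L + suc k * suc m                             ≡⟨ eq₃ (i * L) (suc k) m ⟩
        suc k + (i * L + m * suc k)                       ≤⟨ +-mono-≤ (m≤m*n (suc k) (suc (F m)))
                                                               (<⇒≤ (≰⇒> λ le → ¬x (final m (m≤n+m (n !) p) m<1+n! le))) ⟩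
        suc k * suc (F m) + suc n ! * suc k               ≡⟨ cong (λ v → suc k * suc (F m) + v) (*-comm (suc n !) (suc k)) ⟩
        suc k * suc (F m) + suc k * suc n !               ≡⟨ cong (λ v → suc k * suc v + suc k * suc n !) (count-∉ em {X} {m} ¬x) ⟨
        suc k * suc (F (suc m)) + suc k * suc n !         ∎

  least : (P : ℕ → Set) → (∃ λ n → P n) → ∃ λ m → P m × ∀ l → l < m → ¬ P l
  least P (n , p) with search (suc n)
    where
    search : ∀ n → (∃ λ m → P m × ∀ l → l < m → ¬ P l) ⊎ (∀ l → l < n → ¬ P l)
    search zero    = inj₂ λ _ ()
    search (suc n) with search n | em {P n}
    ... | inj₁ found | _     = inj₁ found
    ... | inj₂ none  | yes p = inj₁ (n , p , none)
    ... | inj₂ none  | no ¬p = inj₂ λ l l<1+n q →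
      [ (λ l<n → none l l<n q) , (λ { refl → ¬p q }) ]′ (m<1+n⇒m<n∨m≡n l<1+n)
  ... | inj₁ found = found
  ... | inj₂ none  = contradiction p (none n (n<1+n n))

-- A Π⁰₁ set for a left-Π⁰₃ real

module _ (em : ExcludedMiddle 0ℓ) (C : Relation 6) where

  -- C z y x a b d is the matrix of a Π⁰₃ definition of the left cut.  Level
  -- (k , i) speaks for the rational i / (k + 1): by stage z, w still looks like
  -- a bound for the witnesses y that the first k + 1 instances x require for
  -- each rational j / (d + 1) ≤ i / (k + 1) with d ≤ k.
  Supported : (z w k i : ℕ) → Set
  Supported z w k i = ∀ d → d < suc k → ∀ j → j < suc (suc k) → j * suc k ≤ℕ i * suc d →
    ∀ x → x < suc k → ∃ λ y → y < w × ∀ z′ → z′ < z → C (z′ ∷ y ∷ x ∷ j ∷ 0 ∷ d ∷ [])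

  -- The conditions k ≤ n and w ≤ n make the later quantifiers over k and w bounded, and ensure that
  -- level k acts only on blocks n ≥ k.
  Refuted : (n w k i : ℕ) → Set
  Refuted n w k i = k ≤ℕ n × w ≤ℕ n × ∀ v → v < w → ¬ Supported n v k i

  FirstRefuted : (n w k i : ℕ) → Set
  FirstRefuted n w k i = Refuted n w k i × ∀ l → l < n → ¬ Refuted l w k i

  -- n settles (k , i) if the least correct bound w exists and n is the first
  -- stage at which all smaller bounds are refuted.  As opposed to the minimality
  -- of w alone, this is a Π⁰₁ property of n, and n is still unique.
  SettlesUpTo : (z n k i : ℕ) → Set
  SettlesUpTo z n k i = ∃ λ w → w < suc n × FirstRefuted n w k i × Supported z w k i

  Settles : (n k i : ℕ) → Set
  Settles n k i = ∃ λ w → FirstRefuted n w k i × ∀ z → Supported z w k i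

  -- Block n is [n! , (n + 1)!), of length n · n!; the condition says that j is in
  -- the last (i / (k + 1))-th part of it.
  Final : (n k i j : ℕ) → Set
  Final n k i j = suc n ! * suc k ≤ℕ i * (n * n !) + j * suc k

  -- All quantifiers are bounded: n by j since n ≤ n!, k by n since settling requires k ≤ n, and i
  -- by k + 1 since only fractions up to 1 matter.
  Stage : (z j : ℕ) → Set
  Stage z j = ∃ λ n → n < suc j × n ! ≤ℕ j × j < suc n ! ×
    ∃ λ k → k < suc n × ∃ λ i → i < suc (suc k) × Final n k i j × SettlesUpTo z n k i

  LimitSet : Pred ℕ 0ℓ
  LimitSet j = ∀ z → Stage z j

  private
    Supportedᴿ Refutedᴿ FirstRefutedᴿ SettlesUpToᴿ : Relation 4
    Supportedᴿ (z ∷ w ∷ k ∷ i ∷ []) = Supported z w k i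
    Refutedᴿ (n ∷ w ∷ k ∷ i ∷ []) = Refuted n w k i
    FirstRefutedᴿ (n ∷ w ∷ k ∷ i ∷ []) = FirstRefuted n w k i
    SettlesUpToᴿ (z ∷ n ∷ k ∷ i ∷ []) = SettlesUpTo z n k i
    Stageᴿ : Relation 2
    Stageᴿ (z ∷ j ∷ []) = Stage z j

  module _ (cC : Computable C) where

    private
      supportedᶜ : Computable Supportedᴿ
      supportedᶜ = computable-resp {S = Supportedᴿ} (λ { (z ∷ w ∷ k ∷ i ∷ []) → mk⇔ id id })
        (∀<ᶜ (recursive-suc (var (# 2))) (∀<ᶜ (recursive-suc (recursive-suc (var (# 3))))
          (var (# 0) ⊛ recursive-suc (var (# 4)) ≤ᶜ var (# 5) ⊛ recursive-suc (var (# 1)) →ᶜ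
           ∀<ᶜ (recursive-suc (var (# 4))) (∃<ᶜ (var (# 4)) (∀<ᶜ (var (# 4))
             (cC [ var (# 0) ∷ var (# 1) ∷ var (# 2) ∷ var (# 3) ∷ const 0 ∷ var (# 4) ∷ [] ]ᶜ))))))

      refutedᶜ : Computable Refutedᴿ
      refutedᶜ = computable-resp {S = Refutedᴿ} (λ { (n ∷ w ∷ k ∷ i ∷ []) → mk⇔ id id })
        (var (# 2) ≤ᶜ var (# 0) ×ᶜ var (# 1) ≤ᶜ var (# 0) ×ᶜ
         ∀<ᶜ (var (# 1)) (¬ᶜ (supportedᶜ [ var (# 1) ∷ var (# 0) ∷ var (# 3) ∷ var (# 4) ∷ [] ]ᶜ)))

      firstRefutedᶜ : Computable FirstRefutedᴿ
      firstRefutedᶜ = computable-resp {S = FirstRefutedᴿ} (λ { (n ∷ w ∷ k ∷ i ∷ []) → mk⇔ id id })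
        (refutedᶜ [ var (# 0) ∷ var (# 1) ∷ var (# 2) ∷ var (# 3) ∷ [] ]ᶜ ×ᶜ
         ∀<ᶜ (var (# 0)) (¬ᶜ (refutedᶜ [ var (# 0) ∷ var (# 2) ∷ var (# 3) ∷ var (# 4) ∷ [] ]ᶜ)))

      settlesUpToᶜ : Computable SettlesUpToᴿ
      settlesUpToᶜ = computable-resp {S = SettlesUpToᴿ} (λ { (z ∷ n ∷ k ∷ i ∷ []) → mk⇔ id id })
        (∃<ᶜ (recursive-suc (var (# 1)))
          (firstRefutedᶜ [ var (# 2) ∷ var (# 0) ∷ var (# 3) ∷ var (# 4) ∷ [] ]ᶜ ×ᶜ
           supportedᶜ [ var (# 1) ∷ var (# 0) ∷ var (# 3) ∷ var (# 4) ∷ [] ]ᶜ))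

      stageᶜ : Computable Stageᴿ
      stageᶜ = computable-resp {S = Stageᴿ} (λ { (z ∷ j ∷ []) → mk⇔ id id })
        (∃<ᶜ (recursive-suc (var (# 1)))
          (recursive-! (var (# 0)) ≤ᶜ var (# 2) ×ᶜ var (# 2) <ᶜ recursive-! (recursive-suc (var (# 0))) ×ᶜ
           ∃<ᶜ (recursive-suc (var (# 0))) (∃<ᶜ (recursive-suc (recursive-suc (var (# 0))))
             (recursive-! (recursive-suc (var (# 2))) ⊛ recursive-suc (var (# 1)) ≤ᶜ
                var (# 0) ⊛ (var (# 2) ⊛ recursive-! (var (# 2))) ⊕ var (# 4) ⊛ recursive-suc (var (# 1)) ×ᶜ
              settlesUpToᶜ [ var (# 3) ∷ var (# 2) ∷ var (# 1) ∷ var (# 0) ∷ [] ]ᶜ))))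

    LimitSet-Π⁰₁ : Π⁰ 1 (fromSet LimitSet)
    LimitSet-Π⁰₁ = Stageᴿ , lift stageᶜ , λ { (j ∷ []) → mk⇔ id id }

  Supported-anti : ∀ w k i {z z′} → z ≤ℕ z′ → Supported z′ w k i → Supported z w k i
  Supported-anti w k i z≤z′ s d d≤k j j≤1+k le x x≤k =
    let y , y<w , c = s d d≤k j j≤1+k le x x≤k in y , y<w , λ v v<z → c v (<-≤-trans v<z z≤z′)

  SettlesUpTo-anti : ∀ n k i {z z′} → z ≤ℕ z′ → SettlesUpTo z′ n k i → SettlesUpTo z n k i
  SettlesUpTo-anti n k i z≤z′ (w , w≤n , f , s) = w , w≤n , f , Supported-anti w k i z≤z′ s

  settlesUpTo⇒settles : ∀ n k i → (∀ z → SettlesUpTo z n k i) → Settles n k i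
  settlesUpTo⇒settles n k i h =
    let w , _ , all = ∃<∀-commute em (suc n) (λ {w} z≤z′ (f , s) → f , Supported-anti w k i z≤z′ s) h
    in w , proj₁ (all 0) , λ z → proj₂ (all z)

  InBlock : (n j : ℕ) → Set
  InBlock n j = ∃ λ k → ∃ λ i → i < suc (suc k) × Final n k i j × Settles n k i

  -- The number j determines its block, so n is the same for all z. The bounded choices of k, i and
  -- then w are moved outside the quantifier over z one after the other.
  limitSet⇒inBlock : ∀ n {j} → n ! ≤ℕ j → j < suc n ! → LimitSet j → InBlock n j
  limitSet⇒inBlock n {j} n!≤j j<1+n! h = level (∃<∀-commute em (suc n) anti₁ h₀)
    where
    At : ℕ → ℕ → ℕ → Set
    At z k i = Final n k i j × SettlesUpTo z n k i
    anti₂ : ∀ k {i z z′} → z ≤ℕ z′ → At z′ k i → At z k i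
    anti₂ k {i} z≤z′ (fin , s) = fin , SettlesUpTo-anti n k i z≤z′ s
    anti₁ : ∀ {k z z′} → z ≤ℕ z′ → (∃ λ i → i < suc (suc k) × At z′ k i) → ∃ λ i → i < suc (suc k) × At z k i
    anti₁ {k} z≤z′ (i , i< , at) = i , i< , anti₂ k {i} z≤z′ at
    h₀ : ∀ z → ∃ λ k → k < suc n × ∃ λ i → i < suc (suc k) × At z k i
    h₀ z with h z
    ... | n′ , _ , n′!≤j , j<1+n′! , rest with !-block-unique n n′ n!≤j j<1+n! n′!≤j j<1+n′!
    ...   | refl = rest
    rational : ∀ k → (∃ λ i → i < suc (suc k) × ∀ z → At z k i) → InBlock n j
    rational k (i , i< , at) = k , i , i< , proj₁ (at 0) , settlesUpTo⇒settles n k i (λ z → proj₂ (at z))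
    level : (∃ λ k → k < suc n × ∀ z → ∃ λ i → i < suc (suc k) × At z k i) → InBlock n j
    level (k , _ , h₁) = rational k (∃<∀-commute em (suc (suc k)) (λ {i} → anti₂ k {i}) h₁)

  inBlock⇒limitSet : ∀ n k i {j} → n ! ≤ℕ j → j < suc n ! → i < suc (suc k) → Final n k i j → Settles n k i →
                     LimitSet j
  inBlock⇒limitSet n k i n!≤j j<1+n! i< fin (w , f@((k≤n , w≤n , _) , _) , s) z =
    n , s≤s (≤-trans (n≤n! n) n!≤j) , n!≤j , j<1+n! , k , s≤s k≤n , i , i< , fin , w , s≤s w≤n , f , s z

  -- A bound smaller than the other would be refuted although it is correct, so the bounds agree;
  -- both stages are then the first one refuting all that lies below.
  settles-unique : ∀ k i {m n} → Settles m k i → Settles n k i → m ≡ n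
  settles-unique k i {m} {n} (v , fv , sv) (w , fw , sw) with <-cmp v w
  ... | tri< v<w _ _ = contradiction (sv n) (proj₂ (proj₂ (proj₁ fw)) v v<w)
  ... | tri> _ _ w<v = contradiction (sw m) (proj₂ (proj₂ (proj₁ fv)) w w<v)
  ... | tri≈ _ refl _ with <-cmp m n
  ...   | tri< m<n _ _ = contradiction (proj₁ fv) (proj₂ fw m m<n)
  ...   | tri≈ _ eq _  = eq
  ...   | tri> _ _ n<m = contradiction (proj₁ fw) (proj₂ fv n n<m)

  -- The least correct bound w exists classically. Each of the finitely many smaller bounds fails at
  -- some stage, hence all of them from a common stage on, and the first suitable stage settles.
  settles-exists : ∀ k i → (∃ λ w → ∀ z → Supported z w k i) → ∃ λ n → k ≤ℕ n × Settles n k i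
  settles-exists k i bound with least em (λ w → ∀ z → Supported z w k i) bound
  ... | w , s , below = stage (least em (λ n → Refuted n w k i) refuted)
    where
    refutation : ∃ λ t → ∀ v → v < w → ¬ Supported t v k i
    refutation = ∀<∃-commute w (λ {v} t≤t′ ¬s s → ¬s (Supported-anti v k i t≤t′ s)) λ v v<w →
      [ (λ all → contradiction all (below v v<w)) , id ]′ (∀⊎∃¬ em (λ z → Supported z v k i))
    refuted : ∃ λ n → Refuted n w k i
    refuted = let t , ¬s = refutation in
      k ⊔ (w ⊔ t) , m≤m⊔n k (w ⊔ t) , ≤-trans (m≤m⊔n w t) (m≤n⊔m k (w ⊔ t)) ,
      λ v v<w s → ¬s v v<w (Supported-anti v k i (≤-trans (m≤n⊔m w t) (m≤n⊔m k (w ⊔ t))) s)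
    stage : (∃ λ n → Refuted n w k i × ∀ l → l < n → ¬ Refuted l w k i) → ∃ λ n → k ≤ℕ n × Settles n k i
    stage (n , r , first) = n , proj₁ r , w , (r , first) , s

  -- The bound w leaves finitely many candidates for y, so the same y serves for all z.
  settles-sound : ∀ k i {n} → Settles n k i →
    ∀ d → d < suc k → ∀ j → j < suc (suc k) → j * suc k ≤ℕ i * suc d →
    ∀ x → x < suc k → ∃ λ y → ∀ z → C (z ∷ y ∷ x ∷ j ∷ 0 ∷ d ∷ [])
  settles-sound k i (w , _ , s) d d≤k j j≤1+k le x x≤k =
    let y , _ , c = ∃<∀-commute em w (λ z≤z′ c v v<z → c v (<-≤-trans v<z z≤z′)) (λ z → s z d d≤k j j≤1+k le x x≤k)
    in y , λ z → c (suc z) z (n<1+n z)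

  -- Level k asks for finitely many instances (d, j, x); w is taken beyond one witness for each.
  supported-complete : ∀ k i →
    (∀ d j → j * suc k ≤ℕ i * suc d → ∀ x → ∃ λ y → ∀ z → C (z ∷ y ∷ x ∷ j ∷ 0 ∷ d ∷ [])) →
    ∃ λ w → ∀ z → Supported z w k i
  supported-complete k i h =
    let w , s = supports in w , λ z d d< j j< le x x< → let y , y<w , c = s d d< j j< le x x< in y , y<w , λ v _ → c v
    where
    Witness : ℕ → ℕ → ℕ → ℕ → Set
    Witness w d j x = ∃ λ y → y < w × ∀ z → C (z ∷ y ∷ x ∷ j ∷ 0 ∷ d ∷ [])
    mono : ∀ {w w′ d j x} → w ≤ℕ w′ → Witness w d j x → Witness w′ d j x
    mono w≤w′ (y , y<w , c) = y , <-≤-trans y<w w≤w′ , c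
    Witnesses : ℕ → ℕ → ℕ → Set
    Witnesses w d j = j * suc k ≤ℕ i * suc d → ∀ x → x < suc k → Witness w d j x
    monos : ∀ d j {w w′} → w ≤ℕ w′ → Witnesses w d j → Witnesses w′ d j
    monos d j w≤w′ s le x x< = mono w≤w′ (s le x x<)
    instances : ∀ d j → Dec (j * suc k ≤ℕ i * suc d) →
                ∃ λ w → Witnesses w d j
    -- Nothing is required of this j / (d + 1), so the default bound 0 will do.
    instances d j (no ¬le) = 0 , λ le → contradiction le ¬le
    instances d j (yes le) =
      let w , all = ∀<∃-commute (suc k) mono λ x _ → let y , c = h d j le x in suc y , y , n<1+n y , c
      in w , λ _ → all
    supports : ∃ λ w → ∀ d → d < suc k → ∀ j → j < suc (suc k) → Witnesses w d j
    supports = ∀<∃-commute (suc k) (λ {d} w≤w′ s j j< → monos d j w≤w′ (s j j<)) λ d _ →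
               ∀<∃-commute (suc (suc k)) (λ {j} → monos d j) λ j _ → instances d j em

  -- Only finitely many levels k can settle an i / (k + 1) ≥ P / (D + 1), and
  -- each of them only at finitely many stages.
  settles-eventually-below : ∀ P D → P ≤ℕ suc D →
    ¬ (∀ x → ∃ λ y → ∀ z → C (z ∷ y ∷ x ∷ P ∷ 0 ∷ D ∷ [])) →
    ∃ λ N → ∀ {n} → N ≤ℕ n → ∀ k i → i < suc (suc k) → Settles n k i → i * suc D < P * suc k
  settles-eventually-below P D P≤1+D ¬cut
    with ∀⊎∃¬ em (λ x → ∃ λ y → ∀ z → C (z ∷ y ∷ x ∷ P ∷ 0 ∷ D ∷ []))
  ... | inj₁ cut      = contradiction cut ¬cut
  ... | inj₂ (x , ¬c) = N , below
    where
    -- From level K on, the rational P / (D + 1) and the failing instance x are among those tested.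
    K = D ⊔ x
    low-levels : ∃ λ N → ∀ k → k < K → ∀ i → i < suc (suc k) → ∀ n → N ≤ℕ n → ¬ Settles n k i
    low-levels =
      ∀<∃-commute K (λ N≤N′ h i i< n N′≤n → h i i< n (≤-trans N≤N′ N′≤n)) λ k _ →
      ∀<∃-commute (suc (suc k)) (λ N≤N′ h n N′≤n → h n (≤-trans N≤N′ N′≤n)) λ i _ → stage k i em
      where
      stage : ∀ k i → Dec (∃ λ n → Settles n k i) → ∃ λ N → ∀ n → N ≤ℕ n → ¬ Settles n k i
      stage k i (no never)    = 0 , λ n _ s → never (n , s)
      stage k i (yes (m , s)) = suc m , λ n m<n s′ → <⇒≢ m<n (settles-unique k i s s′)
    N = proj₁ low-levels
    below : ∀ {n} → N ≤ℕ n → ∀ k i → i < suc (suc k) → Settles n k i → i * suc D < P * suc k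
    below {n} N≤n k i i< s with <-≤-connex k K
    ... | inj₁ k<K = contradiction s (proj₂ low-levels k k<K i i< n N≤n)
    ... | inj₂ K≤k = ≰⇒> λ le → ¬c (settles-sound k i s D (s≤s D≤k) P (s≤s (≤-trans P≤1+D (s≤s D≤k))) le x
                                      (s≤s (≤-trans (m≤n⊔m D x) K≤k)))
      where
      D≤k : D ≤ℕ k
      D≤k = ≤-trans (m≤m⊔n D x) K≤k

-- The upper density of the constructed set

-- With denominators cleared, (a - b) / Q < P / R leaves a gap of at least 1. Over a block of length
-- n · A this gains n · A, more than the a · R · A lost to the numbers before the block and the R ·
-- Q lost to rounding.
exceeds-at-end : ∀ a b P {Q R n A f} .{{_ : NonZero R}} → 0 < A → a * R < P * Q + b * R →
                 P * (n * A) ≤ℕ R * suc f → a * R + R * Q < n → a * (A + n * A) < f * Q + b * (A + n * A)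
exceeds-at-end a b P {Q} {R} {n} {A} {f} A>0 q<P end large =
  *-cancelˡ-< R _ _ (+-cancelʳ-< (R * Q) _ _ (begin-strict
    R * (a * (A + n * A)) + R * Q                 ≤⟨ +-monoʳ-≤ (R * (a * (A + n * A))) (m≤m*n (R * Q) A) ⟩
    R * (a * (A + n * A)) + R * Q * A             ≡⟨ eq₁ R a A n Q ⟩
    (a * R + R * Q) * A + a * R * (n * A)         <⟨ +-monoˡ-< (a * R * (n * A)) (*-monoˡ-< A large) ⟩
    suc (a * R) * (n * A)                         ≤⟨ *-monoˡ-≤ (n * A) q<P ⟩
    (P * Q + b * R) * (n * A)                     ≡⟨ eq₂ P Q b R (n * A) ⟩
    Q * (P * (n * A)) + b * R * (n * A)           ≤⟨ +-mono-≤ (*-monoʳ-≤ Q end) (*-monoʳ-≤ (b * R) (m≤n+m (n * A) A)) ⟩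
    Q * (R * suc f) + b * R * (A + n * A)         ≡⟨ eq₃ Q R f b (A + n * A) ⟩
    R * (f * Q + b * (A + n * A)) + R * Q         ∎))
  where
  open ≤-Reasoning
  instance
    A≢0 : NonZero A
    A≢0 = >-nonZero A>0
  eq₁ : ∀ R a A n Q → R * (a * (A + n * A)) + R * Q * A ≡ (a * R + R * Q) * A + a * R * (n * A)
  eq₁ = solve-∀
  eq₂ : ∀ P Q b R l → (P * Q + b * R) * l ≡ Q * (P * l) + b * R * l
  eq₂ = solve-∀
  eq₃ : ∀ Q R f b M → Q * (R * suc f) + b * R * M ≡ R * (f * Q + b * M) + R * Q
  eq₃ = solve-∀

-- With denominators cleared, P / Q < (a - b) / R leaves a gap of at least 1, which over m numbers
-- amounts to m; the error term c offsets less than R · c of it.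
exceeds⇒small : ∀ a b P {Q R c m f} → P * R + b * Q < a * Q → Q * f ≤ℕ P * m + c →
                a * m < f * R + b * m → m < R * c
exceeds⇒small a b P {Q} {R} {c} {m} {f} P<q upper exceeds =
  +-cancelˡ-< ((P * R + b * Q) * m) _ _ (begin-strict
    (P * R + b * Q) * m + m               ≡⟨ +-comm ((P * R + b * Q) * m) m ⟩
    suc (P * R + b * Q) * m               ≤⟨ *-monoˡ-≤ m P<q ⟩
    a * Q * m                             ≡⟨ eq₁ a Q m ⟩
    Q * (a * m)                           <⟨ *-monoʳ-< Q exceeds ⟩
    Q * (f * R + b * m)                   ≡⟨ eq₂ Q f R b m ⟩
    R * (Q * f) + Q * b * m               ≤⟨ +-monoˡ-≤ (Q * b * m) (*-monoʳ-≤ R upper) ⟩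
    R * (P * m + c) + Q * b * m           ≡⟨ eq₃ R P m c Q b ⟩
    (P * R + b * Q) * m + R * c           ∎)
  where
  open ≤-Reasoning
  instance
    Q≢0 : NonZero Q
    Q≢0 = m*n≢0⇒n≢0 a {{>-nonZero (≤-<-trans z≤n P<q)}}
  eq₁ : ∀ a Q m → a * Q * m ≡ Q * (a * m)
  eq₁ = solve-∀
  eq₂ : ∀ Q f R b m → Q * (f * R + b * m) ≡ R * (Q * f) + Q * b * m
  eq₂ = solve-∀
  eq₃ : ∀ R P m c Q b → R * (P * m + c) + Q * b * m ≡ (P * R + b * Q) * m + R * c
  eq₃ = solve-∀

module _ (em : ExcludedMiddle 0ℓ) (r : ℝ) (0≤r : fromℚ 0ℚ ≤ r) (r≤1 : r ≤ fromℚ 1ℚ) (C : Relation 6)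
         (cut : ∀ a b d → leftCut r ((a ⊖ b) / suc d) ⇔ (∀ x → ∃ λ y → ∀ z → C (z ∷ y ∷ x ∷ a ∷ b ∷ d ∷ [])))
         where

  private
    X : Pred ℕ 0ℓ
    X = LimitSet em C
    F : ℕ → ℕ
    F = count em X
    x : ℕ → ℚ
    x k = ρ {X} (λ _ → em) (suc k)

  level-settles : ∀ k i q → leftCut r q → ¬ q <ℚ + i / suc k → ∃ λ n → k ≤ℕ n × Settles em C n k i
  level-settles k i q q<r i≤q =
    -- `downClosed` needs a strict inequality, but j / (d + 1) may equal q; hence the larger p in
    -- the cut.
    let p , q<p , p<r = ℝ.noMaximum r q<r in
    settles-exists em C k i (supported-complete em C k i λ d j le →
      to (cut j 0 d) (ℝ.downClosed r (ℚ.≤-<-trans (ℚ.≮⇒≥ λ q<j → i≤q (ℚ.<-≤-trans q<j (ℚ.≮⇒≥ λ i<j →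
        <⇒≱ (to (+/-<+/⇔ i k j d) i<j) le))) q<p) p<r))

  dense-often : ∀ a b d P D → leftCut r (+ P / suc D) → (a ⊖ b) / suc d <ℚ + P / suc D →
                ∀ N → ∃ λ k → (a ⊖ b) / suc d <ℚ x (N + k)
  dense-often a b d P D P<r q<P N = at-end (level-settles k i (+ P / suc D) P<r same)
    where
    -- P / (D + 1) is expanded by t + 1 into i / (k + 1), which moves it to a level k ≥ t. The value
    -- of t exceeds both N and the threshold of `exceeds-at-end`.
    t = N + suc (a * suc D + suc D * suc d)
    k = t + D * suc t
    i = P * suc t
    same : ¬ + P / suc D <ℚ + i / suc k
    same P<i = <-irrefl (eq P t D) (to (+/-<+/⇔ P D i k) P<i)
      where
      eq : ∀ P t D → P * (suc D * suc t) ≡ P * suc t * suc D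
      eq = solve-∀
    P≤1+D : P ≤ℕ suc D
    P≤1+D = subst₂ _≤ℕ_ (*-identityʳ P) (*-identityˡ (suc D)) (<⇒≤ (to (+/-<+/⇔ P D 1 0) (r≤1 P<r)))
    i≤1+k : i ≤ℕ suc k
    i≤1+k = *-monoˡ-≤ (suc t) P≤1+D
    t≤k : t ≤ℕ k
    t≤k = m≤m+n t (D * suc t)
    index : ∀ M → N < M → a * M < F M * suc d + b * M → ∃ λ k → (a ⊖ b) / suc d <ℚ x (N + k)
    index (suc m) (s≤s N≤m) exceeds =
      m ∸ N , subst (λ k → (a ⊖ b) / suc d <ℚ x k) (sym (m+[n∸m]≡n N≤m)) (from (below-ρ⇔ em a b d X m) exceeds)
    at-end : (∃ λ n → k ≤ℕ n × Settles em C n k i) → ∃ λ k → (a ⊖ b) / suc d <ℚ x (N + k)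
    at-end (n , k≤n , settles) = index (suc n !) (≤-trans (s≤s (≤-trans (m≤m+n N _) t≤n)) (n≤n! (suc n)))
      (exceeds-at-end a b P (n!>0 n) (to (⊖/-<+/⇔ a b d P D) q<P) end (≤-trans (m≤n+m _ N) t≤n))
      where
      t≤n : t ≤ℕ n
      t≤n = ≤-trans t≤k k≤n
      lower : i * (n * n !) ≤ℕ suc k * suc (F (suc n !))
      lower = count-lower em {X} {n} {k} {i} i≤1+k λ m n!≤m m<1+n! fin →
        inBlock⇒limitSet em C n k i n!≤m m<1+n! (s≤s i≤1+k) fin settles
      end : P * (n * n !) ≤ℕ suc D * suc (F (suc n !))
      end = *-cancelˡ-≤ (suc t) (subst₂ _≤ℕ_ (eqˡ P (suc t) (n * n !)) (eqʳ D t (F (suc n !))) lower)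
        where
        eqˡ : ∀ P s l → P * s * l ≡ s * (P * l)
        eqˡ = solve-∀
        eqʳ : ∀ D t f → suc D * suc t * suc f ≡ suc t * (suc D * suc f)
        eqʳ = solve-∀

  often : ∀ q → leftCut r q → ∀ N → ∃ λ k → q <ℚ x (N + k)
  often q q<r N = let p , q<p , p<r = ℝ.noMaximum r q<r in cases p q<p p<r (negative⊎+/ p) (⊖/-surjective q)
    where
    cases : ∀ p → q <ℚ p → leftCut r p → (p <ℚ 0ℚ ⊎ ∃ λ P → ∃ λ D → p ≡ + P / suc D) →
            (∃ λ a → ∃ λ b → ∃ λ d → q ≡ (a ⊖ b) / suc d) → ∃ λ k → q <ℚ x (N + k)
    cases p q<p p<r (inj₁ p<0) _ = 0 , ℚ.<-≤-trans (ℚ.<-trans q<p p<0) (ρ-≥0 em X (N + 0))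
    cases p q<p p<r (inj₂ (P , D , refl)) (a , b , d , refl) = dense-often a b d P D p<r q<p N

  eventually-≮ : ∀ a b d P D → ¬ leftCut r (+ P / suc D) → + P / suc D <ℚ (a ⊖ b) / suc d →
                 ∃ λ N → ∀ k → ¬ (a ⊖ b) / suc d <ℚ x (N + k)
  eventually-≮ a b d P D P≮r P<q = cases (≤-<-connex P (suc D))
    where
    cases : P ≤ℕ suc D ⊎ suc D < P → ∃ λ N → ∀ k → ¬ (a ⊖ b) / suc d <ℚ x (N + k)
    -- Here q exceeds P / (D + 1) > 1, and no partial density exceeds 1.
    cases (inj₂ D<P) = 0 , λ k q<x → ρ-≮1 em X k (ℚ.<-trans
      (from (+/-<+/⇔ 1 0 P D) (subst₂ _<_ (sym (*-identityˡ (suc D))) (sym (*-identityʳ P)) D<P)) (ℚ.<-trans P<q q<x))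
    -- The first summand is the threshold of `exceeds⇒small` for the error term (D + 1) · N!, the
    -- second that of `count-upper`.
    cases (inj₁ P≤1+D) = suc d * (suc D * N !) + N ! , small
      where
      below : ∃ λ N → ∀ {n} → N ≤ℕ n → ∀ k i → i < suc (suc k) → Settles em C n k i → i * suc D < P * suc k
      below = settles-eventually-below em C P D P≤1+D (λ h → P≮r (from (cut P 0 D) h))
      N = proj₁ below
      -- From block N on, only fractions i / (k + 1) below P / (D + 1) settle, so their final parts
      -- lie within the larger final part for P / (D + 1).
      final : ∀ {n m} → N ≤ℕ n → n ! ≤ℕ m → m < suc n ! → X m → suc D * suc n ! ≤ℕ P * (n * n !) + m * suc D
      final {n} {m} N≤n n!≤m m<1+n! xm with limitSet⇒inBlock em C n n!≤m m<1+n! xm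
      ... | k , i , i< , fin , settles = *-cancelˡ-≤ (suc k) (begin
        suc k * (suc D * suc n !)                          ≡⟨ eq₁ k D (suc n !) ⟩
        suc D * (suc n ! * suc k)                          ≤⟨ *-monoʳ-≤ (suc D) fin ⟩
        suc D * (i * (n * n !) + m * suc k)                ≡⟨ eq₂ D i (n * n !) m k ⟩
        i * suc D * (n * n !) + suc D * (m * suc k)        ≤⟨ +-monoˡ-≤ (suc D * (m * suc k)) (*-monoˡ-≤ (n * n !) (<⇒≤ (proj₂ below N≤n k i i< settles))) ⟩
        P * suc k * (n * n !) + suc D * (m * suc k)        ≡⟨ eq₃ P k (n * n !) D m ⟩
        suc k * (P * (n * n !) + m * suc D)                ∎)
        where
        open ≤-Reasoning
        eq₁ : ∀ k D M → suc k * (suc D * M) ≡ suc D * (M * suc k)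
        eq₁ = solve-∀
        eq₂ : ∀ D i l m k → suc D * (i * l + m * suc k) ≡ i * suc D * l + suc D * (m * suc k)
        eq₂ = solve-∀
        eq₃ : ∀ P k l D m → P * suc k * l + suc D * (m * suc k) ≡ suc k * (P * l + m * suc D)
        eq₃ = solve-∀
      small : ∀ k → ¬ (a ⊖ b) / suc d <ℚ x (suc d * (suc D * N !) + N ! + k)
      small k q<x = <⇒≱ (exceeds⇒small a b P separated upper (to (below-ρ⇔ em a b d X m) q<x))
                        (≤-trans (m≤m+n _ (N !)) (≤-trans (m≤m+n _ k) (n≤1+n m)))
        where
        m = suc d * (suc D * N !) + N ! + k
        separated : P * suc d + b * suc D < a * suc D
        separated = subst (P * suc d + b * suc D <_) (+-identityʳ (a * suc D)) (to (⊖/-<⇔ P 0 D a b d) P<q)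
        upper : suc D * F (suc m) ≤ℕ P * suc m + suc D * N !
        upper = count-upper em {X} {P} {suc D} {N} P≤1+D final (suc m)
                  (≤-trans (m≤n+m (N !) (suc d * (suc D * N !))) (≤-trans (m≤m+n _ k) (n≤1+n m)))

  eventually : ∀ p q → ¬ leftCut r p → p <ℚ q → ∃ λ N → ∀ k → ¬ q <ℚ x (N + k)
  eventually p q p≮r p<q = cases (negative⊎+/ p) (⊖/-surjective q)
    where
    cases : (p <ℚ 0ℚ ⊎ ∃ λ P → ∃ λ D → p ≡ + P / suc D) → (∃ λ a → ∃ λ b → ∃ λ d → q ≡ (a ⊖ b) / suc d) →
            ∃ λ N → ∀ k → ¬ q <ℚ x (N + k)
    cases (inj₁ p<0) _ = contradiction (0≤r p<0) p≮r
    cases (inj₂ (P , D , refl)) (a , b , d , refl) = eventually-≮ a b d P D p≮r p<q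

  limitSet-upperDensity : IsUpperDensity em X r
  limitSet-upperDensity = isLimsup-intro x (+ 1 / 1 , ρ-≮1 em X) r often eventually em

proposition6p1 : (em : ExcludedMiddle 0ℓ) (r : ℝ) → fromℚ 0ℚ ≤ r → r ≤ fromℚ 1ℚ →
    ((∃ λ (X : Pred ℕ 0ℓ) → Σ⁰ 2 (fromSet X) × IsUpperDensity em X r) ⇔ LeftΠ⁰₃ r)
    × (LeftΠ⁰₃ r ⇔ (∃ λ (X : Pred ℕ 0ℓ) → Π⁰ 1 (fromSet X) × IsUpperDensity em X r))
proposition6p1 em r 0≤r r≤1 =
  -- Two implications suffice, since every Π⁰₁ set is Σ⁰₂.
  mk⇔ cut-Π⁰₃ (λ π → let X , π₁ , lim = realise π in X , Π⁰₁⇒Σ⁰₂ π₁ , lim) ,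
  mk⇔ realise (λ (X , π₁ , lim) → cut-Π⁰₃ (X , Π⁰₁⇒Σ⁰₂ π₁ , lim))
  where
  cut-Π⁰₃ : (∃ λ (X : Pred ℕ 0ℓ) → Σ⁰ 2 (fromSet X) × IsUpperDensity em X r) → LeftΠ⁰₃ r
  cut-Π⁰₃ (X , σ , lim) = Σ⁰₂-upperDensity⇒LeftΠ⁰₃ em {X} {r} σ lim
  realise : LeftΠ⁰₃ r → ∃ λ (X : Pred ℕ 0ℓ) → Π⁰ 1 (fromSet X) × IsUpperDensity em X r
  realise π with Π⁰₃-elim π
  ... | C , cC , cut = LimitSet em C , LimitSet-Π⁰₁ em C cC ,
    limitSet-upperDensity em r 0≤r r≤1 C (λ a b d → cut (a ∷ b ∷ d ∷ []))
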